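{- Some properties of distributions on $[n]$ require $\Omega(n)$ conditional samples to test (adaptively or not). That is, there exist constants $\epsilon>0$, $c>0$ and, for every $n$, a set $\mathcal P_n$ of distributions over $[n]$, such that for all sufficiently large $n$ every (adaptive or non-adaptive) distribution tester for $\mathcal P_n$, with distance parameter $\epsilon$ and error bound $\delta=\frac13$, must use at least $cn$ conditional samples.
   Context: $[n]=\{1,\ldots,n\}$; the variation distance is $d(\mu,\mu')=\frac12\sum_{i=1}^n|\mu(i)-\mu'(i)|$. A property is a set of distributions over $[n]$ (not required to be invariant under permutations of $[n]$). $\mu$ is $\epsilon$-far from $\mathcal P$ if $d(\mu,\mu')\ge\epsilon$ for every $\mu'\in\mathcal P$. A conditional sampling oracle for $\mu$ takes a nonempty set $A\subseteq[n]$ and returns $j\in A$ with probability $\mu(j)/\mu(A)$ if $\mu(A)>0$, and a uniformly random member of $A$ if $\mu(A)=0$, independently of all previous samples. An adaptive distribution tester for $\mathcal P$ is a randomized algorithm that in each phase chooses a conditioning set based on the previously received samples and its internal coin tosses and receives the oracle's answer, and finally accepts or rejects; it must accept with probability at least $1-\delta$ if $\mu\in\mathcal P$ and reject with probability at least $1-\delta$ if $\mu$ is $\epsilon$-far from $\mathcal P$. A non-adaptive tester is one that fixes all conditioning sets before receiving any sample. -}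

module Defs where

open import Data.Bool.Base using (Bool; true; false; if_then_else_)
open import Data.Bool.Properties using () renaming (_≟_ to _≟ᵇ_)
open import Data.Fin.Base using (Fin)
open import Data.Fin.Subset using (Subset; Nonempty; _∈_; _∉_) renaming (∣_∣ to card)
import Data.Integer.Base as ℤ
open import Data.Nat.Base as ℕ using (ℕ; suc)
import Data.Nat.Properties as ℕ
open import Data.Product.Base using (Σ; ∃; _×_; _,_)
open import Data.Rational.Base as ℚ using (ℚ; 0ℚ; 1ℚ; ½)
import Data.Rational.Properties as ℚ
open import Data.Rational.Solver using (module +-*-Solver)
open import Data.Sum.Base using (inj₁; inj₂)
open import Data.Vec.Base using (Vec; []; _∷_; lookup)
open import Data.Vec.Functional using (foldr)
open import Relation.Binary.PropositionalEquality
  using (_≡_; refl; sym; trans; cong; subst)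
open import Relation.Nullary.Decidable using (⌊_⌋)

-- The real numbers: Cauchy sequences of rationals with a modulus of
-- convergence, considered up to the equivalence _≈_ below.

IsCauchy : (ℕ → ℚ) → Set
IsCauchy s = ∀ ε → 0ℚ ℚ.< ε →
  ∃ λ N → ∀ m n → N ℕ.≤ m → N ℕ.≤ n → ℚ.∣ s m ℚ.- s n ∣ ℚ.< ε

record ℝ : Set where
  constructor mkℝ
  field
    seq    : ℕ → ℚ
    cauchy : IsCauchy seq

open ℝ public

infix 4 _≈_ _≤_ _<_

record _≈_ (x y : ℝ) : Set where
  constructor ≈-intro
  field ≈-elim : ∀ ε → 0ℚ ℚ.< ε →
          ∃ λ N → ∀ n → N ℕ.≤ n → ℚ.∣ seq x n ℚ.- seq y n ∣ ℚ.< ε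

record _≤_ (x y : ℝ) : Set where
  constructor ≤-intro
  field ≤-elim : ∀ ε → 0ℚ ℚ.< ε →
          ∃ λ N → ∀ n → N ℕ.≤ n → seq x n ℚ.< seq y n ℚ.+ ε

record _<_ (x y : ℝ) : Set where
  constructor <-intro
  field <-elim : ∃ λ ε → 0ℚ ℚ.< ε ×
          ∃ λ N → ∀ n → N ℕ.≤ n → seq x n ℚ.+ ε ℚ.< seq y n

open _≈_ public
open _≤_ public
open _<_ public

half-pos : ∀ {ε} → 0ℚ ℚ.< ε → 0ℚ ℚ.< ½ ℚ.* ε
half-pos {ε} 0<ε =
  subst (ℚ._< ½ ℚ.* ε) (ℚ.*-zeroʳ ½) (ℚ.*-monoʳ-<-pos ½ 0<ε)

half+half : ∀ ε → ½ ℚ.* ε ℚ.+ ½ ℚ.* ε ≡ ε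
half+half ε = trans (sym (ℚ.*-distribʳ-+ ε ½ ½)) (ℚ.*-identityˡ ε)

divide-pos : ∀ {B ε} → 0ℚ ℚ.< B → 0ℚ ℚ.< ε → ∃ λ δ → 0ℚ ℚ.< δ × B ℚ.* δ ≡ ε
divide-pos {B} {ε} 0<B 0<ε = B⁻¹ ℚ.* ε , 0<δ , Bδ≡ε
  where
  instance
    B-pos : ℚ.Positive B
    B-pos = ℚ.positive 0<B
    B-nonZero : ℚ.NonZero B
    B-nonZero = ℚ.pos⇒nonZero B

  B⁻¹ : ℚ
  B⁻¹ = ℚ.1/ B

  0<δ : 0ℚ ℚ.< B⁻¹ ℚ.* ε
  0<δ = subst (ℚ._< B⁻¹ ℚ.* ε) (ℚ.*-zeroʳ B⁻¹)
    (ℚ.*-monoʳ-<-pos B⁻¹ {{ℚ.1/pos⇒pos B}} 0<ε)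

  Bδ≡ε : B ℚ.* (B⁻¹ ℚ.* ε) ≡ ε
  Bδ≡ε = trans (sym (ℚ.*-assoc B B⁻¹ ε))
    (trans (cong (ℚ._* ε) (ℚ.*-inverseʳ B)) (ℚ.*-identityˡ ε))

cauchy⇒bounded : ∀ {s} → IsCauchy s →
  ∃ λ B → 0ℚ ℚ.< B × ∃ λ N → ∀ n → N ℕ.≤ n → ℚ.∣ s n ∣ ℚ.≤ B
cauchy⇒bounded {s} c with c 1ℚ (ℚ.positive⁻¹ 1ℚ)
... | N , close = 1ℚ ℚ.+ ℚ.∣ s N ∣ , 0<B , N , bound
  where
  open ℚ.≤-Reasoning

  0<B : 0ℚ ℚ.< 1ℚ ℚ.+ ℚ.∣ s N ∣
  0<B = ℚ.+-mono-<-≤ (ℚ.positive⁻¹ 1ℚ) (ℚ.0≤∣p∣ (s N))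

  bound : ∀ n → N ℕ.≤ n → ℚ.∣ s n ∣ ℚ.≤ 1ℚ ℚ.+ ℚ.∣ s N ∣
  bound n N≤n = begin
    ℚ.∣ s n ∣                         ≡⟨ cong ℚ.∣_∣ (solve 2 (λ a b → a := (a :- b) :+ b) refl (s n) (s N)) ⟩
    ℚ.∣ (s n ℚ.- s N) ℚ.+ s N ∣       ≤⟨ ℚ.∣p+q∣≤∣p∣+∣q∣ (s n ℚ.- s N) (s N) ⟩
    ℚ.∣ s n ℚ.- s N ∣ ℚ.+ ℚ.∣ s N ∣   ≤⟨ ℚ.+-monoˡ-≤ ℚ.∣ s N ∣ (ℚ.<⇒≤ (close n N N≤n ℕ.≤-refl)) ⟩
    1ℚ ℚ.+ ℚ.∣ s N ∣                  ∎
    where open +-*-Solver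

∣p∣-∣q∣≤∣p-q∣ : ∀ p q → ℚ.∣ p ∣ ℚ.- ℚ.∣ q ∣ ℚ.≤ ℚ.∣ p ℚ.- q ∣
∣p∣-∣q∣≤∣p-q∣ p q = begin
  ℚ.∣ p ∣ ℚ.- ℚ.∣ q ∣                       ≡⟨ cong (λ r → ℚ.∣ r ∣ ℚ.- ℚ.∣ q ∣) (solve 2 (λ x y → x := (x :- y) :+ y) refl p q) ⟩
  ℚ.∣ (p ℚ.- q) ℚ.+ q ∣ ℚ.- ℚ.∣ q ∣         ≤⟨ ℚ.+-monoˡ-≤ (ℚ.- ℚ.∣ q ∣) (ℚ.∣p+q∣≤∣p∣+∣q∣ (p ℚ.- q) q) ⟩
  (ℚ.∣ p ℚ.- q ∣ ℚ.+ ℚ.∣ q ∣) ℚ.- ℚ.∣ q ∣   ≡⟨ solve 2 (λ x y → (x :+ y) :- y := x) refl ℚ.∣ p ℚ.- q ∣ ℚ.∣ q ∣ ⟩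
  ℚ.∣ p ℚ.- q ∣                             ∎
  where
  open ℚ.≤-Reasoning
  open +-*-Solver

∣∣p∣-∣q∣∣≤∣p-q∣ : ∀ p q → ℚ.∣ ℚ.∣ p ∣ ℚ.- ℚ.∣ q ∣ ∣ ℚ.≤ ℚ.∣ p ℚ.- q ∣
∣∣p∣-∣q∣∣≤∣p-q∣ p q with ℚ.∣p∣≡p∨∣p∣≡-p (ℚ.∣ p ∣ ℚ.- ℚ.∣ q ∣)
... | inj₁ eq = subst (ℚ._≤ ℚ.∣ p ℚ.- q ∣) (sym eq) (∣p∣-∣q∣≤∣p-q∣ p q)
... | inj₂ eq = begin
  ℚ.∣ ℚ.∣ p ∣ ℚ.- ℚ.∣ q ∣ ∣   ≡⟨ trans eq (swap ℚ.∣ p ∣ ℚ.∣ q ∣) ⟩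
  ℚ.∣ q ∣ ℚ.- ℚ.∣ p ∣         ≤⟨ ∣p∣-∣q∣≤∣p-q∣ q p ⟩
  ℚ.∣ q ℚ.- p ∣               ≡⟨ trans (cong ℚ.∣_∣ (sym (swap p q))) (ℚ.∣-p∣≡∣p∣ (p ℚ.- q)) ⟩
  ℚ.∣ p ℚ.- q ∣               ∎
  where
  open ℚ.≤-Reasoning
  open +-*-Solver

  swap : ∀ x y → ℚ.- (x ℚ.- y) ≡ y ℚ.- x
  swap = solve 2 (λ x y → :- (x :- y) := y :- x) refl

∣-p--q∣≡∣p-q∣ : ∀ p q → ℚ.∣ ℚ.- p ℚ.- ℚ.- q ∣ ≡ ℚ.∣ p ℚ.- q ∣
∣-p--q∣≡∣p-q∣ p q =
  trans (cong ℚ.∣_∣ (sym (ℚ.neg-distrib-+ p (ℚ.- q)))) (ℚ.∣-p∣≡∣p∣ (p ℚ.- q))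

+-close : ∀ {ε} a a′ b b′ →
  ℚ.∣ a ℚ.- a′ ∣ ℚ.< ½ ℚ.* ε → ℚ.∣ b ℚ.- b′ ∣ ℚ.< ½ ℚ.* ε →
  ℚ.∣ (a ℚ.+ b) ℚ.- (a′ ℚ.+ b′) ∣ ℚ.< ε
+-close {ε} a a′ b b′ a-close b-close = begin-strict
  ℚ.∣ (a ℚ.+ b) ℚ.- (a′ ℚ.+ b′) ∣           ≡⟨ cong ℚ.∣_∣ (regroup a b a′ b′) ⟩
  ℚ.∣ (a ℚ.- a′) ℚ.+ (b ℚ.- b′) ∣           ≤⟨ ℚ.∣p+q∣≤∣p∣+∣q∣ (a ℚ.- a′) (b ℚ.- b′) ⟩
  ℚ.∣ a ℚ.- a′ ∣ ℚ.+ ℚ.∣ b ℚ.- b′ ∣         <⟨ ℚ.+-mono-< a-close b-close ⟩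
  ½ ℚ.* ε ℚ.+ ½ ℚ.* ε                       ≡⟨ half+half ε ⟩
  ε                                         ∎
  where
  open ℚ.≤-Reasoning
  open +-*-Solver

  regroup : ∀ p q r s → (p ℚ.+ q) ℚ.- (r ℚ.+ s) ≡ (p ℚ.- r) ℚ.+ (q ℚ.- s)
  regroup = solve 4 (λ p q r s → (p :+ q) :- (r :+ s) := (p :- r) :+ (q :- s)) refl

*-bound-< : ∀ a b {B δ} → 0ℚ ℚ.< B → ℚ.∣ a ∣ ℚ.≤ B → ℚ.∣ b ∣ ℚ.< δ →
  ℚ.∣ a ℚ.* b ∣ ℚ.< B ℚ.* δ
*-bound-< a b {B} {δ} 0<B a≤B b<δ = begin-strict
  ℚ.∣ a ℚ.* b ∣           ≡⟨ ℚ.∣p*q∣≡∣p∣*∣q∣ a b ⟩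
  ℚ.∣ a ∣ ℚ.* ℚ.∣ b ∣     ≤⟨ ℚ.*-monoʳ-≤-nonNeg ℚ.∣ b ∣ {{ℚ.∣-∣-nonNeg b}} a≤B ⟩
  B ℚ.* ℚ.∣ b ∣           <⟨ ℚ.*-monoʳ-<-pos B {{ℚ.positive 0<B}} b<δ ⟩
  B ℚ.* δ                 ∎
  where open ℚ.≤-Reasoning

*-close : ∀ {A B δ η ε} a a′ b b′ → 0ℚ ℚ.< A → 0ℚ ℚ.< B →
  A ℚ.* η ≡ ½ ℚ.* ε → B ℚ.* δ ≡ ½ ℚ.* ε →
  ℚ.∣ a ∣ ℚ.≤ A → ℚ.∣ b′ ∣ ℚ.≤ B →
  ℚ.∣ a ℚ.- a′ ∣ ℚ.< δ → ℚ.∣ b ℚ.- b′ ∣ ℚ.< η →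
  ℚ.∣ a ℚ.* b ℚ.- a′ ℚ.* b′ ∣ ℚ.< ε
*-close {ε = ε} a a′ b b′ 0<A 0<B Aη≡½ε Bδ≡½ε a≤A b′≤B a-close b-close = begin-strict
  ℚ.∣ a ℚ.* b ℚ.- a′ ℚ.* b′ ∣
    ≡⟨ cong ℚ.∣_∣ (regroup a b a′ b′) ⟩
  ℚ.∣ a ℚ.* (b ℚ.- b′) ℚ.+ b′ ℚ.* (a ℚ.- a′) ∣
    ≤⟨ ℚ.∣p+q∣≤∣p∣+∣q∣ (a ℚ.* (b ℚ.- b′)) (b′ ℚ.* (a ℚ.- a′)) ⟩
  ℚ.∣ a ℚ.* (b ℚ.- b′) ∣ ℚ.+ ℚ.∣ b′ ℚ.* (a ℚ.- a′) ∣
    <⟨ ℚ.+-mono-<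
         (subst (ℚ.∣ a ℚ.* (b ℚ.- b′) ∣ ℚ.<_) Aη≡½ε (*-bound-< a (b ℚ.- b′) 0<A a≤A b-close))
         (subst (ℚ.∣ b′ ℚ.* (a ℚ.- a′) ∣ ℚ.<_) Bδ≡½ε (*-bound-< b′ (a ℚ.- a′) 0<B b′≤B a-close)) ⟩
  ½ ℚ.* ε ℚ.+ ½ ℚ.* ε   ≡⟨ half+half ε ⟩
  ε                     ∎
  where
  open ℚ.≤-Reasoning
  open +-*-Solver

  regroup : ∀ p q r s → p ℚ.* q ℚ.- r ℚ.* s ≡ p ℚ.* (q ℚ.- s) ℚ.+ s ℚ.* (p ℚ.- r)
  regroup = solve 4 (λ p q r s →
    p :* q :- r :* s := p :* (q :- s) :+ s :* (p :- r)) refl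

-- The moduli of convergence are never computed with; unfolding them would make
-- typechecking impractically slow.
abstract
  const-cauchy : ∀ q → IsCauchy (λ _ → q)
  const-cauchy q ε 0<ε =
    0 , λ _ _ _ _ → subst (ℚ._< ε) (sym (cong ℚ.∣_∣ (ℚ.+-inverseʳ q))) 0<ε

  +-cauchy : ∀ x y → IsCauchy (λ n → seq x n ℚ.+ seq y n)
  +-cauchy (mkℝ s cˢ) (mkℝ t cᵗ) ε 0<ε =
    let M , closeˢ = cˢ (½ ℚ.* ε) (half-pos 0<ε)
        N , closeᵗ = cᵗ (½ ℚ.* ε) (half-pos 0<ε)
    in M ℕ.⊔ N , λ m n ≤m ≤n →
      +-close (s m) (s n) (t m) (t n)
        (closeˢ m n (ℕ.m⊔n≤o⇒m≤o M N ≤m) (ℕ.m⊔n≤o⇒m≤o M N ≤n))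
        (closeᵗ m n (ℕ.m⊔n≤o⇒n≤o M N ≤m) (ℕ.m⊔n≤o⇒n≤o M N ≤n))

  neg-cauchy : ∀ x → IsCauchy (λ n → ℚ.- seq x n)
  neg-cauchy (mkℝ s c) ε 0<ε =
    let N , close = c ε 0<ε in
    N , λ m n N≤m N≤n →
      subst (ℚ._< ε) (sym (∣-p--q∣≡∣p-q∣ (s m) (s n))) (close m n N≤m N≤n)

  abs-cauchy : ∀ x → IsCauchy (λ n → ℚ.∣ seq x n ∣)
  abs-cauchy (mkℝ s c) ε 0<ε =
    let N , close = c ε 0<ε in
    N , λ m n N≤m N≤n →
      ℚ.≤-<-trans (∣∣p∣-∣q∣∣≤∣p-q∣ (s m) (s n)) (close m n N≤m N≤n)

  *-cauchy : ∀ x y → IsCauchy (λ n → seq x n ℚ.* seq y n)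
  *-cauchy (mkℝ s cˢ) (mkℝ t cᵗ) ε 0<ε =
    let A , 0<A , Nᵃ , s≤A = cauchy⇒bounded cˢ
        B , 0<B , Nᵇ , t≤B = cauchy⇒bounded cᵗ
        η , 0<η , Aη≡½ε    = divide-pos 0<A (half-pos 0<ε)
        δ , 0<δ , Bδ≡½ε    = divide-pos 0<B (half-pos 0<ε)
        Nˢ , closeˢ        = cˢ δ 0<δ
        Nᵗ , closeᵗ        = cᵗ η 0<η
        Nᵃᵇ                = Nᵃ ℕ.⊔ Nᵇ
        Nˢᵗ                = Nˢ ℕ.⊔ Nᵗ
    in Nᵃᵇ ℕ.⊔ Nˢᵗ , λ m n ≤m ≤n →
      let ab≤m = ℕ.m⊔n≤o⇒m≤o Nᵃᵇ Nˢᵗ ≤m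
          ab≤n = ℕ.m⊔n≤o⇒m≤o Nᵃᵇ Nˢᵗ ≤n
          st≤m = ℕ.m⊔n≤o⇒n≤o Nᵃᵇ Nˢᵗ ≤m
          st≤n = ℕ.m⊔n≤o⇒n≤o Nᵃᵇ Nˢᵗ ≤n
      in *-close (s m) (s n) (t m) (t n) 0<A 0<B Aη≡½ε Bδ≡½ε
           (s≤A m (ℕ.m⊔n≤o⇒m≤o Nᵃ Nᵇ ab≤m))
           (t≤B n (ℕ.m⊔n≤o⇒n≤o Nᵃ Nᵇ ab≤n))
           (closeˢ m n (ℕ.m⊔n≤o⇒m≤o Nˢ Nᵗ st≤m) (ℕ.m⊔n≤o⇒m≤o Nˢ Nᵗ st≤n))
           (closeᵗ m n (ℕ.m⊔n≤o⇒n≤o Nˢ Nᵗ st≤m) (ℕ.m⊔n≤o⇒n≤o Nˢ Nᵗ st≤n))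

fromℚ : ℚ → ℝ
fromℚ q = mkℝ (λ _ → q) (const-cauchy q)

fromℕ : ℕ → ℝ
fromℕ n = fromℚ (ℤ.+ n ℚ./ 1)

0ℝ 1ℝ : ℝ
0ℝ = fromℚ 0ℚ
1ℝ = fromℚ 1ℚ

infixl 7 _*_
infixl 6 _+_ _-_
infix  8 -_

_+_ : ℝ → ℝ → ℝ
x + y = mkℝ (λ n → seq x n ℚ.+ seq y n) (+-cauchy x y)

-_ : ℝ → ℝ
- x = mkℝ (λ n → ℚ.- seq x n) (neg-cauchy x)

_-_ : ℝ → ℝ → ℝ
x - y = x + (- y)

_*_ : ℝ → ℝ → ℝ
x * y = mkℝ (λ n → seq x n ℚ.* seq y n) (*-cauchy x y)

∣_∣ : ℝ → ℝ
∣ x ∣ = mkℝ (λ n → ℚ.∣ seq x n ∣) (abs-cauchy x)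

∑ : ∀ {n} → (Fin n → ℝ) → ℝ
∑ = foldr _+_ 0ℝ

record Distribution (n : ℕ) : Set where
  field
    prob        : Fin n → ℝ
    nonNegative : ∀ i → 0ℝ ≤ prob i
    total       : ∑ prob ≈ 1ℝ

open Distribution public

mass : ∀ {n} → Distribution n → Subset n → ℝ
mass μ A = ∑ λ i → if lookup A i then prob μ i else 0ℝ

variation : ∀ {n} → Distribution n → Distribution n → ℝ
variation μ μ′ = fromℚ ½ * ∑ λ i → ∣ prob μ i - prob μ′ i ∣

-- A set of distributions has to respect equality of real numbers.
record Property (n : ℕ) : Set₁ where
  field
    Member  : Distribution n → Set
    respect : ∀ μ μ′ → (∀ i → prob μ i ≈ prob μ′ i) → Member μ → Member μ′

open Property public

Far : ∀ {n} → ℝ → Property n → Distribution n → Set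
Far ε P μ = ∀ μ′ → Member P μ′ → ε ≤ variation μ μ′

-- The law of the oracle's answer to each nonempty set.
Oracle : ℕ → Set
Oracle n = (A : Subset n) → Nonempty A → Distribution n

-- The quotients μ(j)/μ(A) and 1/|A| are cleared of denominators, so that no
-- decision whether μ(A) vanishes, unavailable constructively, is required.
record IsConditional {n} (μ : Distribution n) (O : Oracle n) : Set where
  field
    outside-A : ∀ A ne j → j ∉ A → prob (O A ne) j ≈ 0ℝ
    positive  : ∀ A ne j → j ∈ A → 0ℝ < mass μ A →
                prob (O A ne) j * mass μ A ≈ prob μ j
    null      : ∀ A ne j → j ∈ A → mass μ A ≈ 0ℝ →
                prob (O A ne) j * fromℕ (card A) ≈ 1ℝ

-- A randomized adaptive algorithm using at most q samples, as a decision tree;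
-- a toss is an internal coin with k sides of arbitrary bias, and true means accept.
data Adaptive (n : ℕ) : ℕ → Set where
  output : ∀ {q} → Bool → Adaptive n q
  toss   : ∀ {q k} → Distribution k → (Fin k → Adaptive n q) → Adaptive n q
  sample : ∀ {q} (A : Subset n) → Nonempty A → (Fin n → Adaptive n q) → Adaptive n (suc q)

-- Using a fresh answer at every sample node makes the samples independent.
outcome : ∀ {n q} → Oracle n → Adaptive n q → Bool → ℝ
outcome O (output b′)     b = if ⌊ b′ ≟ᵇ b ⌋ then 1ℝ else 0ℝ
outcome O (toss ρ t)      b = ∑ λ r → prob ρ r * outcome O (t r) b
outcome O (sample A ne t) b = ∑ λ j → prob (O A ne) j * outcome O (t j) b

record IsTester {n q} (P : Property n) (ε δ : ℝ) (T : Adaptive n q) : Set where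
  field
    completeness : ∀ μ → Member P μ → ∀ O → IsConditional μ O →
                   1ℝ - δ ≤ outcome O T true
    soundness    : ∀ μ → Far ε P μ → ∀ O → IsConditional μ O →
                   1ℝ - δ ≤ outcome O T false

Query : ℕ → Set
Query n = Σ (Subset n) Nonempty

-- All internal coins are tossed in advance; their result r determines both the
-- conditioning sets and the rule deciding on the received samples.
record NonAdaptive (n q : ℕ) : Set where
  field
    {sides}  : ℕ
    coin     : Distribution sides
    queries  : Fin sides → Vec (Query n) q
    decision : Fin sides → Vec (Fin n) q → Bool

sampleAll : ∀ {n q} → Vec (Query n) q → (Vec (Fin n) q → Bool) → Adaptive n q
sampleAll []              decide = output (decide [])
sampleAll ((A , ne) ∷ As) decide = sample A ne λ j → sampleAll As λ js → decide (j ∷ js)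

toAdaptive : ∀ {n q} → NonAdaptive n q → Adaptive n q
toAdaptive T = toss coin λ r → sampleAll (queries r) (decision r)
  where open NonAdaptive T

{-# OPTIONS --safe #-}
module Submission where

-- Encode words x_a of a binary code of length m = n/2 − O(1) by distributions μ_a
-- with weights 3, 1 or 1, 3 on one pair of points per bit. A conditional
-- sample is simulated by rejection, each trial reading one bit and succeeding
-- with probability at least 1/4, so the acceptance probability of a q-sample
-- tester is, up to 1/12, a polynomial of degree D = 6q + 19 in the bits. A greedy
-- code with distance linear in n has more words than there are monomials of
-- degree at most k = ⌊n/40⌋, so linear algebra gives coefficients z_a, not all
-- zero, with Σ z_a p(x_a) = 0 for all polynomials p of degree at most k. For the
-- property {μ_a : z_a > 0} the remaining μ_a are far from it, and a tester
-- with D ≤ k would make z_a (p(x_a) − 1/2) ≥ ∣z_a∣/12 for every a, whence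
-- Σ z_a p(x_a) > 0.

import Data.Rational.Properties as ℚ
open import Algebra.Bundles using (CommutativeRing)
open import Algebra.Properties.Semiring.Sum
  (CommutativeRing.semiring ℚ.+-*-commutativeRing)
  using (sum; sum-cong-≗; sum-remove; sum-replicate-zero; ∑-comm; ∑-distrib-+;
         *-distribˡ-sum; *-distribʳ-sum)
open import Data.Bool.Base using (Bool; true; false; if_then_else_)
import Data.Empty as Empty
open import Data.Fin.Base using (Fin; zero; suc; punchIn)
import Data.Fin.Properties as Fin
open import Data.Fin.Subset using (Subset; Nonempty; inside; outside; ⊥; _∉_) renaming (∣_∣ to card)
open import Data.Fin.Subset.Properties using (∣⊥∣≡0)
open import Data.Integer.Base using (+_)
import Data.Integer.Base as ℤ
import Data.Integer.Properties as ℤ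
open import Data.List.Base as List using (List; []; _∷_; _++_; map; length)
open import Data.List.Membership.Propositional using (_∈_)
open import Data.List.Membership.Propositional.Properties using (∈-map⁺; ∈-++⁺ˡ; ∈-++⁺ʳ)
import Data.List.Properties as List
open import Data.List.Relation.Unary.Any using (here; index)
open import Data.List.Relation.Unary.Any.Properties using (lookup-index)
open import Data.Nat.Base as ℕ using (ℕ; zero; suc; z≤n; s≤s)
import Data.Nat.DivMod as ℕ
import Data.Nat.Properties as ℕ
import Data.Nat.Solver as ℕ
open import Data.Product.Base using (∃; ∃-syntax; _×_; _,_; proj₁; proj₂)
open import Data.Rational.Base as ℚ using (ℚ; 0ℚ; 1ℚ; ½)
open import Data.Rational.Base using (_/_)
open import Data.Rational.Solver using (module +-*-Solver)
import Data.Rational.Unnormalised.Base as ℚᵘ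
import Data.Rational.Unnormalised.Properties as ℚᵘ
open import Data.Sum.Base using (_⊎_; inj₁; inj₂)
open import Data.Vec.Base using (Vec; []; _∷_; lookup; _[_]≔_)
open import Data.Vec.Functional using (insertAt)
open import Data.Vec.Functional.Properties using (insertAt-lookup; insertAt-punchIn)
open import Data.Vec.Properties using ([]=⇒lookup; lookup⇒[]=)
open import Function.Base using (_∘_)
open import Relation.Binary.PropositionalEquality
  using (_≡_; _≢_; refl; sym; trans; cong; cong₂; subst; subst₂; module ≡-Reasoning)
open import Relation.Nullary.Decidable using (yes; no; ¬?; decidable-stable; toWitness)
open import Relation.Nullary.Negation using (contradiction)
open import Defs

-- Inequalities between rationals and between Cauchy reals

p≤q⇒0≤q-p : ∀ {p q} → p ℚ.≤ q → 0ℚ ℚ.≤ q ℚ.- p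
p≤q⇒0≤q-p {p} {q} p≤q =
  subst (ℚ._≤ q ℚ.- p) (ℚ.+-inverseʳ p) (ℚ.+-monoˡ-≤ (ℚ.- p) p≤q)

0≤q-p⇒p≤q : ∀ {p q} → 0ℚ ℚ.≤ q ℚ.- p → p ℚ.≤ q
0≤q-p⇒p≤q {p} {q} 0≤q-p =
  subst₂ ℚ._≤_ (ℚ.+-identityʳ p) (solve 2 (λ p q → p :+ (q :- p) := q) refl p q)
    (ℚ.+-monoʳ-≤ p 0≤q-p)
  where open +-*-Solver

0≤p*q : ∀ {p q} → 0ℚ ℚ.≤ p → 0ℚ ℚ.≤ q → 0ℚ ℚ.≤ p ℚ.* q
0≤p*q {p} {q} 0≤p 0≤q =
  subst (ℚ._≤ p ℚ.* q) (ℚ.*-zeroʳ p) (ℚ.*-monoˡ-≤-nonNeg p {{ℚ.nonNegative 0≤p}} 0≤q)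

0≤p+q : ∀ {p q} → 0ℚ ℚ.≤ p → 0ℚ ℚ.≤ q → 0ℚ ℚ.≤ p ℚ.+ q
0≤p+q = ℚ.+-mono-≤

p<p+q : ∀ p {q} → 0ℚ ℚ.< q → p ℚ.< p ℚ.+ q
p<p+q p {q} 0<q = subst (ℚ._< p ℚ.+ q) (ℚ.+-identityʳ p) (ℚ.+-monoʳ-< p 0<q)

p≤p+q : ∀ p {q} → 0ℚ ℚ.≤ q → p ℚ.≤ p ℚ.+ q
p≤p+q p {q} 0≤q = subst (ℚ._≤ p ℚ.+ q) (ℚ.+-identityʳ p) (ℚ.+-monoʳ-≤ p 0≤q)

p≤q+p : ∀ p {q} → 0ℚ ℚ.≤ q → p ℚ.≤ q ℚ.+ p
p≤q+p p {q} 0≤q = subst (p ℚ.≤_) (ℚ.+-comm p q) (p≤p+q p 0≤q)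

p≤∣p∣ : ∀ p → p ℚ.≤ ℚ.∣ p ∣
p≤∣p∣ p with ℚ.≤-total 0ℚ p
... | inj₁ 0≤p = ℚ.≤-reflexive (sym (ℚ.0≤p⇒∣p∣≡p 0≤p))
... | inj₂ p≤0 = ℚ.≤-trans p≤0 (ℚ.0≤∣p∣ p)

sum-mono-≤ : ∀ {n} {f g : Fin n → ℚ} → (∀ i → f i ℚ.≤ g i) → sum f ℚ.≤ sum g
sum-mono-≤ {zero}  f≤g = ℚ.≤-refl
sum-mono-≤ {suc n} f≤g = ℚ.+-mono-≤ (f≤g zero) (sum-mono-≤ (f≤g ∘ suc))

0≤sum : ∀ {n} {f : Fin n → ℚ} → (∀ i → 0ℚ ℚ.≤ f i) → 0ℚ ℚ.≤ sum f
0≤sum {n} {f} 0≤f = subst (ℚ._≤ sum f) (sum-replicate-zero n) (sum-mono-≤ 0≤f)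

term≤sum : ∀ {n} {f : Fin n → ℚ} → (∀ i → 0ℚ ℚ.≤ f i) → ∀ i → f i ℚ.≤ sum f
term≤sum {suc n} {f} 0≤f zero =
  subst (ℚ._≤ sum f) (ℚ.+-identityʳ _) (ℚ.+-monoʳ-≤ (f zero) (0≤sum (0≤f ∘ suc)))
term≤sum {suc n} {f} 0≤f (suc i) =
  subst (ℚ._≤ sum f) (ℚ.+-identityˡ _) (ℚ.+-mono-≤ (0≤f zero) (term≤sum (0≤f ∘ suc) i))

seq-∑ : ∀ {n} (f : Fin n → ℝ) ν → seq (∑ f) ν ≡ sum (λ i → seq (f i) ν)
seq-∑ {zero}  f ν = refl
seq-∑ {suc n} f ν = cong (seq (f zero) ν ℚ.+_) (seq-∑ (f ∘ suc) ν)

pointwise-≤ : ∀ {x y} → (∀ ν → seq x ν ℚ.≤ seq y ν) → x ≤ y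
pointwise-≤ {x} {y} x≤y = ≤-intro λ ε 0<ε → 0 , λ ν _ →
  ℚ.≤-<-trans (x≤y ν) (p<p+q (seq y ν) 0<ε)

pointwise-≈ : ∀ {x y} → (∀ ν → seq x ν ≡ seq y ν) → x ≈ y
pointwise-≈ {x} {y} x≡y = ≈-intro λ ε 0<ε → 0 , λ ν _ →
  subst (λ r → ℚ.∣ seq x ν ℚ.- r ∣ ℚ.< ε) (x≡y ν)
    (subst (ℚ._< ε) (sym (cong ℚ.∣_∣ (ℚ.+-inverseʳ (seq x ν)))) 0<ε)

fromℚ-mono-≤ : ∀ {p q} → p ℚ.≤ q → fromℚ p ≤ fromℚ q
fromℚ-mono-≤ p≤q = pointwise-≤ λ _ → p≤q

fromℚ-mono-< : ∀ {p q} → p ℚ.< q → fromℚ p < fromℚ q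
fromℚ-mono-< {p} {q} p<q = <-intro (½ ℚ.* (q ℚ.- p) , half-pos 0<q-p , 0 , λ _ _ → p+½[q-p]<q)
  where
  open +-*-Solver

  0<q-p : 0ℚ ℚ.< q ℚ.- p
  0<q-p = subst (ℚ._< q ℚ.- p) (ℚ.+-inverseʳ p) (ℚ.+-monoˡ-< (ℚ.- p) p<q)

  p+½[q-p]<q : p ℚ.+ ½ ℚ.* (q ℚ.- p) ℚ.< q
  p+½[q-p]<q = subst (p ℚ.+ ½ ℚ.* (q ℚ.- p) ℚ.<_)
    (solve 2 (λ p q → p :+ con ½ :* (q :- p) :+ con ½ :* (q :- p) := q) refl p q)
    (p<p+q (p ℚ.+ ½ ℚ.* (q ℚ.- p)) (half-pos 0<q-p))

fromℚ-cancel-≤ : ∀ {p q} → fromℚ p ≤ fromℚ q → p ℚ.≤ q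
fromℚ-cancel-≤ {p} {q} p≤q with p ℚ.≤? q
... | yes p≤q′ = p≤q′
... | no  p≰q  = contradiction p<p (ℚ.<-irrefl refl)
  where
  open +-*-Solver

  0<p-q : 0ℚ ℚ.< p ℚ.- q
  0<p-q = subst (ℚ._< p ℚ.- q) (ℚ.+-inverseʳ q) (ℚ.+-monoˡ-< (ℚ.- q) (ℚ.≰⇒> p≰q))

  p<p : p ℚ.< p
  p<p with ≤-elim p≤q (p ℚ.- q) 0<p-q
  ... | N , p< = subst (p ℚ.<_) (solve 2 (λ p q → q :+ (p :- q) := p) refl p q) (p< N ℕ.≤-refl)

≤-refl : ∀ {x} → x ≤ x
≤-refl = pointwise-≤ λ _ → ℚ.≤-refl

≤-trans : ∀ {x y z} → x ≤ y → y ≤ z → x ≤ z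
≤-trans {x} {y} {z} x≤y y≤z = ≤-intro λ ε 0<ε →
  let M , x<y = ≤-elim x≤y (½ ℚ.* ε) (half-pos 0<ε)
      N , y<z = ≤-elim y≤z (½ ℚ.* ε) (half-pos 0<ε)
  in M ℕ.⊔ N , λ ν ≤ν → begin-strict
    seq x ν                                <⟨ x<y ν (ℕ.m⊔n≤o⇒m≤o M N ≤ν) ⟩
    seq y ν ℚ.+ ½ ℚ.* ε                    <⟨ ℚ.+-monoˡ-< (½ ℚ.* ε) (y<z ν (ℕ.m⊔n≤o⇒n≤o M N ≤ν)) ⟩
    seq z ν ℚ.+ ½ ℚ.* ε ℚ.+ ½ ℚ.* ε        ≡⟨ ℚ.+-assoc (seq z ν) (½ ℚ.* ε) (½ ℚ.* ε) ⟩
    seq z ν ℚ.+ (½ ℚ.* ε ℚ.+ ½ ℚ.* ε)      ≡⟨ cong (seq z ν ℚ.+_) (half+half ε) ⟩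
    seq z ν ℚ.+ ε                          ∎
  where open ℚ.≤-Reasoning

≈-sym : ∀ {x y} → x ≈ y → y ≈ x
≈-sym {x} {y} x≈y = ≈-intro λ ε 0<ε →
  let N , close = ≈-elim x≈y ε 0<ε in
  N , λ ν N≤ν → subst (ℚ._< ε) (distance-comm (seq x ν) (seq y ν)) (close ν N≤ν)
  where
  open +-*-Solver

  distance-comm : ∀ p q → ℚ.∣ p ℚ.- q ∣ ≡ ℚ.∣ q ℚ.- p ∣
  distance-comm p q = trans (sym (ℚ.∣-p∣≡∣p∣ (p ℚ.- q)))
    (cong ℚ.∣_∣ (solve 2 (λ p q → :- (p :- q) := q :- p) refl p q))

≈-trans : ∀ {x y z} → x ≈ y → y ≈ z → x ≈ z
≈-trans {x} {y} {z} x≈y y≈z = ≈-intro λ ε 0<ε →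
  let M , xy-close = ≈-elim x≈y (½ ℚ.* ε) (half-pos 0<ε)
      N , yz-close = ≈-elim y≈z (½ ℚ.* ε) (half-pos 0<ε)
  in M ℕ.⊔ N , λ ν ≤ν →
    subst (λ r → ℚ.∣ r ∣ ℚ.< ε)
      (solve 3 (λ x y z → (x :+ y) :- (y :+ z) := x :- z) refl (seq x ν) (seq y ν) (seq z ν))
      (+-close (seq x ν) (seq y ν) (seq y ν) (seq z ν)
        (xy-close ν (ℕ.m⊔n≤o⇒m≤o M N ≤ν)) (yz-close ν (ℕ.m⊔n≤o⇒n≤o M N ≤ν)))
  where open +-*-Solver

≈⇒≤ : ∀ {x y} → x ≈ y → x ≤ y
≈⇒≤ {x} {y} x≈y = ≤-intro λ ε 0<ε →
  let N , close = ≈-elim x≈y ε 0<ε in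
  N , λ ν N≤ν → subst (ℚ._< seq y ν ℚ.+ ε)
    (solve 2 (λ x y → y :+ (x :- y) := x) refl (seq x ν) (seq y ν))
    (ℚ.+-monoʳ-< (seq y ν) (ℚ.≤-<-trans (p≤∣p∣ _) (close ν N≤ν)))
  where open +-*-Solver

+-mono-≤ : ∀ {x x′ y y′} → x ≤ x′ → y ≤ y′ → x + y ≤ x′ + y′
+-mono-≤ {x} {x′} {y} {y′} x≤x′ y≤y′ = ≤-intro λ ε 0<ε →
  let M , x<x′ = ≤-elim x≤x′ (½ ℚ.* ε) (half-pos 0<ε)
      N , y<y′ = ≤-elim y≤y′ (½ ℚ.* ε) (half-pos 0<ε)
  in M ℕ.⊔ N , λ ν ≤ν → begin-strict
    seq x ν ℚ.+ seq y ν
      <⟨ ℚ.+-mono-< (x<x′ ν (ℕ.m⊔n≤o⇒m≤o M N ≤ν)) (y<y′ ν (ℕ.m⊔n≤o⇒n≤o M N ≤ν)) ⟩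
    (seq x′ ν ℚ.+ ½ ℚ.* ε) ℚ.+ (seq y′ ν ℚ.+ ½ ℚ.* ε)
      ≡⟨ solve 3 (λ x y e → (x :+ con ½ :* e) :+ (y :+ con ½ :* e) := x :+ y :+ e) refl
           (seq x′ ν) (seq y′ ν) ε ⟩
    seq x′ ν ℚ.+ seq y′ ν ℚ.+ ε   ∎
  where
  open ℚ.≤-Reasoning
  open +-*-Solver

-- A product of two reals above -δ, each bounded by B, is at least -Bδ: either
-- both are negative, or one of them is in [0, B].
almost-nonneg-* : ∀ {B δ a b} → 0ℚ ℚ.≤ B → 0ℚ ℚ.≤ δ →
  a ℚ.≤ B → b ℚ.≤ B → ℚ.- δ ℚ.≤ a → ℚ.- δ ℚ.≤ b → 0ℚ ℚ.≤ a ℚ.* b ℚ.+ B ℚ.* δ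
almost-nonneg-* {B} {δ} {a} {b} 0≤B 0≤δ a≤B b≤B -δ≤a -δ≤b
  with ℚ.≤-total 0ℚ a | ℚ.≤-total 0ℚ b
... | inj₁ 0≤a | _ = subst (0ℚ ℚ.≤_)
  (solve 4 (λ a b B d → a :* (b :- (:- d)) :+ (B :- a) :* d := a :* b :+ B :* d) refl a b B δ)
  (0≤p+q (0≤p*q 0≤a (p≤q⇒0≤q-p -δ≤b)) (0≤p*q (p≤q⇒0≤q-p a≤B) 0≤δ))
  where open +-*-Solver
... | inj₂ a≤0 | inj₁ 0≤b = subst (0ℚ ℚ.≤_)
  (solve 4 (λ a b B d → b :* (a :- (:- d)) :+ (B :- b) :* d := a :* b :+ B :* d) refl a b B δ)
  (0≤p+q (0≤p*q 0≤b (p≤q⇒0≤q-p -δ≤a)) (0≤p*q (p≤q⇒0≤q-p b≤B) 0≤δ))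
  where open +-*-Solver
... | inj₂ a≤0 | inj₂ b≤0 = subst (0ℚ ℚ.≤_)
  (solve 4 (λ a b B d → (con 0ℚ :- a) :* (con 0ℚ :- b) :+ B :* d := a :* b :+ B :* d) refl a b B δ)
  (0≤p+q (0≤p*q (p≤q⇒0≤q-p a≤0) (p≤q⇒0≤q-p b≤0)) (0≤p*q 0≤B 0≤δ))
  where open +-*-Solver

*-monoˡ-≤ : ∀ {x y} z → 0ℝ ≤ z → x ≤ y → z * x ≤ z * y
*-monoˡ-≤ {x} {y} z 0≤z x≤y = ≤-intro λ ε 0<ε →
  let A , 0<A , Nᵃ , z≤A = cauchy⇒bounded (cauchy z)
      B , 0<B , Nᵇ , d≤B = cauchy⇒bounded (cauchy (y - x))
      0≤A+B              = 0≤p+q (ℚ.<⇒≤ 0<A) (ℚ.<⇒≤ 0<B)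
      δ , 0<δ , Cδ≡½ε    = divide-pos (ℚ.+-mono-<-≤ 0<A (ℚ.<⇒≤ 0<B)) (half-pos 0<ε)
      Nᶻ , z-small       = ≤-elim 0≤z δ 0<δ
      Nᵈ , d-small       = ≤-elim x≤y δ 0<δ
      Nᵃᵇ                = Nᵃ ℕ.⊔ Nᵇ
      Nᶻᵈ                = Nᶻ ℕ.⊔ Nᵈ
  in Nᵃᵇ ℕ.⊔ Nᶻᵈ , λ ν ≤ν →
    let ab≤ν = ℕ.m⊔n≤o⇒m≤o Nᵃᵇ Nᶻᵈ ≤ν
        zd≤ν = ℕ.m⊔n≤o⇒n≤o Nᵃᵇ Nᶻᵈ ≤ν
        X = seq x ν
        Y = seq y ν
        Z = seq z ν
        Z≤A   = ℚ.≤-trans (p≤∣p∣ Z) (z≤A ν (ℕ.m⊔n≤o⇒m≤o Nᵃ Nᵇ ab≤ν))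
        Y-X≤B = ℚ.≤-trans (p≤∣p∣ (Y ℚ.- X)) (d≤B ν (ℕ.m⊔n≤o⇒n≤o Nᵃ Nᵇ ab≤ν))
        -δ≤Z  = 0≤q-p⇒p≤q (subst (0ℚ ℚ.≤_) (solve 2 (λ Z d → (Z :+ d) :- con 0ℚ := Z :- (:- d)) refl Z δ)
                  (p≤q⇒0≤q-p (ℚ.<⇒≤ (z-small ν (ℕ.m⊔n≤o⇒m≤o Nᶻ Nᵈ zd≤ν)))))
        -δ≤Y-X = 0≤q-p⇒p≤q (subst (0ℚ ℚ.≤_) (solve 3 (λ X Y d → (Y :+ d) :- X := (Y :- X) :- (:- d)) refl
             X Y δ)
                  (p≤q⇒0≤q-p (ℚ.<⇒≤ (d-small ν (ℕ.m⊔n≤o⇒n≤o Nᶻ Nᵈ zd≤ν)))))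
        open ℚ.≤-Reasoning
    in begin-strict
      Z ℚ.* X                                    ≤⟨ 0≤q-p⇒p≤q (subst (0ℚ ℚ.≤_)
          (solve 5 (λ X Y Z C d → Z :* (Y :- X) :+ C :* d := (Z :* Y :+ C :* d) :- Z :* X) refl
               X Y Z (A ℚ.+ B) δ)
          (almost-nonneg-* 0≤A+B (ℚ.<⇒≤ 0<δ)
             (ℚ.≤-trans Z≤A (p≤p+q A (ℚ.<⇒≤ 0<B)))
             (ℚ.≤-trans Y-X≤B (p≤q+p B (ℚ.<⇒≤ 0<A)))
             -δ≤Z -δ≤Y-X)) ⟩
      Z ℚ.* Y ℚ.+ (A ℚ.+ B) ℚ.* δ                ≡⟨ cong (Z ℚ.* Y ℚ.+_) Cδ≡½ε ⟩
      Z ℚ.* Y ℚ.+ ½ ℚ.* ε                        <⟨ p<p+q (Z ℚ.* Y ℚ.+ ½ ℚ.* ε) (half-pos 0<ε) ⟩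
      Z ℚ.* Y ℚ.+ ½ ℚ.* ε ℚ.+ ½ ℚ.* ε
        ≡⟨ solve 2 (λ W e → W :+ con ½ :* e :+ con ½ :* e := W :+ e) refl (Z ℚ.* Y) ε ⟩
      Z ℚ.* Y ℚ.+ ε                              ∎
  where open +-*-Solver

∑-mono-≤ : ∀ {n} {f g : Fin n → ℝ} → (∀ i → f i ≤ g i) → ∑ f ≤ ∑ g
∑-mono-≤ {zero}  f≤g = ≤-refl
∑-mono-≤ {suc n} f≤g = +-mono-≤ (f≤g zero) (∑-mono-≤ (f≤g ∘ suc))

0≤∑ : ∀ {n} {f : Fin n → ℝ} → (∀ i → 0ℝ ≤ f i) → 0ℝ ≤ ∑ f
0≤∑ {zero}  0≤f = ≤-refl
0≤∑ {suc n} 0≤f = ≤-trans (pointwise-≤ λ _ → ℚ.≤-refl) (+-mono-≤ (0≤f zero) (0≤∑ (0≤f ∘ suc)))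

0≤x*y : ∀ {x y} → 0ℝ ≤ x → 0ℝ ≤ y → 0ℝ ≤ x * y
0≤x*y {x} {y} 0≤x 0≤y = ≤-trans
  (pointwise-≤ λ ν → ℚ.≤-reflexive (sym (ℚ.*-zeroʳ (seq x ν)))) (*-monoˡ-≤ x 0≤x 0≤y)

-- Linear algebra and a code of large distance

p*q≢0 : ∀ {p q} → p ≢ 0ℚ → q ≢ 0ℚ → p ℚ.* q ≢ 0ℚ
p*q≢0 {p} {q} p≢0 q≢0 pq≡0 = p≢0 (begin
  p                       ≡⟨ ℚ.*-identityʳ p ⟨
  p ℚ.* 1ℚ                ≡⟨ cong (p ℚ.*_) (ℚ.*-inverseʳ q) ⟨
  p ℚ.* (q ℚ.* ℚ.1/ q)    ≡⟨ ℚ.*-assoc p q (ℚ.1/ q) ⟨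
  p ℚ.* q ℚ.* ℚ.1/ q      ≡⟨ cong (ℚ._* ℚ.1/ q) pq≡0 ⟩
  0ℚ ℚ.* ℚ.1/ q           ≡⟨ ℚ.*-zeroˡ (ℚ.1/ q) ⟩
  0ℚ                      ∎)
  where
  open ≡-Reasoning
  instance
    q-nonZero : ℚ.NonZero q
    q-nonZero = ℚ.≢-nonZero q≢0

sum-zero : ∀ {n} {f : Fin n → ℚ} → (∀ i → f i ≡ 0ℚ) → sum f ≡ 0ℚ
sum-zero {n} f≡0 = trans (sum-cong-≗ f≡0) (sum-replicate-zero n)

-- Gaussian elimination, with the pivot row subtracted after cross-multiplication.
kernel-nontrivial : ∀ {E N} → E ℕ.< N → (A : Fin E → Fin N → ℚ) →
  ∃ λ (x : Fin N → ℚ) → (∃ λ a → x a ≢ 0ℚ) × (∀ e → sum (λ a → x a ℚ.* A e a) ≡ 0ℚ)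
kernel-nontrivial {zero} (s≤s z≤n) A = (λ _ → 1ℚ) , (zero , λ ()) , λ ()
kernel-nontrivial {suc E} {suc N} (s≤s E<N) A
  with Fin.any? (λ a → ¬? (A zero a ℚ.≟ 0ℚ))
... | no A₀≡0 with kernel-nontrivial (ℕ.m<n⇒m<1+n E<N) (A ∘ suc)
...   | x , x≢0 , x-null = x , x≢0 , λ where
  zero    → sum-zero λ a → trans
    (cong (x a ℚ.*_) (decidable-stable (A zero a ℚ.≟ 0ℚ) λ ≢0 → A₀≡0 (a , ≢0)))
    (ℚ.*-zeroʳ (x a))
  (suc e) → x-null e
kernel-nontrivial {suc E} {suc N} (s≤s E<N) A | yes (p , pivot≢0) = extension
  where
  reduce : (Fin (suc N) → ℚ) → Fin N → ℚ
  reduce s a = s (punchIn p a) ℚ.* A zero p ℚ.- A zero (punchIn p a) ℚ.* s p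

  extension : ∃ λ (x : Fin (suc N) → ℚ) →
    (∃ λ a → x a ≢ 0ℚ) × (∀ e → sum (λ a → x a ℚ.* A e a) ≡ 0ℚ)
  extension with kernel-nontrivial E<N (reduce ∘ A ∘ suc)
  ... | y , (b , yb≢0) , y-null = x , (punchIn p b , xb≢0) , λ where
      zero    → trans (sum-x (A zero)) (sum-zero λ a →
        solve 3 (λ y s t → y :* (s :* t :- s :* t) := con 0ℚ) refl (y a) (A zero (punchIn p a)) (A zero p))
      (suc e) → trans (sum-x (A (suc e))) (y-null e)
    where
    open +-*-Solver

    x₀ : ℚ
    x₀ = sum λ a → ℚ.- (y a ℚ.* A zero (punchIn p a))

    x : Fin (suc N) → ℚ
    x = insertAt (λ a → y a ℚ.* A zero p) p x₀

    xb≢0 : x (punchIn p b) ≢ 0ℚ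
    xb≢0 = subst (_≢ 0ℚ) (sym (insertAt-punchIn _ p x₀ b)) (p*q≢0 yb≢0 pivot≢0)

    sum-x : ∀ s → sum (λ a → x a ℚ.* s a) ≡ sum (λ a → y a ℚ.* reduce s a)
    sum-x s = begin
      sum (λ a → x a ℚ.* s a)
        ≡⟨ sum-remove {i = p} (λ a → x a ℚ.* s a) ⟩
      x p ℚ.* s p ℚ.+ sum (λ a → x (punchIn p a) ℚ.* s (punchIn p a))
        ≡⟨ cong₂ ℚ._+_ (cong (ℚ._* s p) (insertAt-lookup _ p x₀))
             (sum-cong-≗ λ a → cong (ℚ._* s (punchIn p a)) (insertAt-punchIn _ p x₀ a)) ⟩
      x₀ ℚ.* s p ℚ.+ sum (λ a → y a ℚ.* A zero p ℚ.* s (punchIn p a))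
        ≡⟨ cong (ℚ._+ sum (λ a → y a ℚ.* A zero p ℚ.* s (punchIn p a)))
             (*-distribʳ-sum (s p) (λ a → ℚ.- (y a ℚ.* A zero (punchIn p a)))) ⟩
      sum (λ a → ℚ.- (y a ℚ.* A zero (punchIn p a)) ℚ.* s p) ℚ.+
      sum (λ a → y a ℚ.* A zero p ℚ.* s (punchIn p a))
        ≡⟨ ∑-distrib-+ (λ a → ℚ.- (y a ℚ.* A zero (punchIn p a)) ℚ.* s p) _ ⟨
      sum (λ a → ℚ.- (y a ℚ.* A zero (punchIn p a)) ℚ.* s p ℚ.+ y a ℚ.* A zero p ℚ.* s (punchIn p a))
        ≡⟨ sum-cong-≗ (λ a → solve 5 (λ y r s t u →
             :- (y :* r) :* s :+ y :* t :* u := y :* (u :* t :- r :* s)) refl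
             (y a) (A zero (punchIn p a)) (s p) (A zero p) (s (punchIn p a))) ⟩
      sum (λ a → y a ℚ.* reduce s a) ∎
      where open ≡-Reasoning

smallSubsets : ∀ m → ℕ → List (Subset m)
smallSubsets zero    d       = [] ∷ []
smallSubsets (suc m) zero    = map (outside ∷_) (smallSubsets m zero)
smallSubsets (suc m) (suc d) =
  map (outside ∷_) (smallSubsets m (suc d)) ++ map (inside ∷_) (smallSubsets m d)

∈-smallSubsets : ∀ {m d} (S : Subset m) → card S ℕ.≤ d → S ∈ smallSubsets m d
∈-smallSubsets []                      _       = here refl
∈-smallSubsets {d = zero}  (false ∷ S) S≤d     = ∈-map⁺ (outside ∷_) (∈-smallSubsets S S≤d)
∈-smallSubsets {d = suc d} (false ∷ S) S≤d     = ∈-++⁺ˡ (∈-map⁺ (outside ∷_) (∈-smallSubsets S S≤d))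
∈-smallSubsets {d = suc d} (true ∷ S) (s≤s S≤d) =
  ∈-++⁺ʳ (map (outside ∷_) (smallSubsets _ (suc d))) (∈-map⁺ (inside ∷_) (∈-smallSubsets S S≤d))

-- Compares coefficients in (1 + z)^m at z = 1/3.
length-smallSubsets : ∀ m d → length (smallSubsets m d) ℕ.* 3 ℕ.^ m ℕ.≤ 4 ℕ.^ m ℕ.* 3 ℕ.^ d
length-smallSubsets zero    d    = subst (1 ℕ.≤_) (sym (ℕ.*-identityˡ _)) (ℕ.m^n>0 3 d)
length-smallSubsets (suc m) zero = begin
  length (map (outside ∷_) (smallSubsets m 0)) ℕ.* (3 ℕ.* 3 ℕ.^ m)
    ≡⟨ cong (ℕ._* (3 ℕ.* 3 ℕ.^ m)) (List.length-map _ (smallSubsets m 0)) ⟩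
  length (smallSubsets m 0) ℕ.* (3 ℕ.* 3 ℕ.^ m)
    ≡⟨ solve 2 (λ l t → l :* (con 3 :* t) := con 3 :* (l :* t)) refl (length (smallSubsets m 0)) (3 ℕ.^ m) ⟩
  3 ℕ.* (length (smallSubsets m 0) ℕ.* 3 ℕ.^ m)
    ≤⟨ ℕ.*-mono-≤ (ℕ.n≤1+n 3) (length-smallSubsets m 0) ⟩
  4 ℕ.* (4 ℕ.^ m ℕ.* 1)
    ≡⟨ ℕ.*-assoc 4 (4 ℕ.^ m) 1 ⟨
  4 ℕ.* 4 ℕ.^ m ℕ.* 1 ∎
  where
  open ℕ.≤-Reasoning
  open ℕ.+-*-Solver
length-smallSubsets (suc m) (suc d) = begin
  length (map (outside ∷_) S ++ map (inside ∷_) S′) ℕ.* (3 ℕ.* 3 ℕ.^ m)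
    ≡⟨ cong (ℕ._* (3 ℕ.* 3 ℕ.^ m)) (trans (List.length-++ (map (outside ∷_) S))
         (cong₂ ℕ._+_ (List.length-map _ S) (List.length-map _ S′))) ⟩
  (length S ℕ.+ length S′) ℕ.* (3 ℕ.* 3 ℕ.^ m)
    ≡⟨ solve 3 (λ l l′ t → (l :+ l′) :* (con 3 :* t) := con 3 :* (l :* t) :+ con 3 :* (l′ :* t)) refl
         (length S) (length S′) (3 ℕ.^ m) ⟩
  3 ℕ.* (length S ℕ.* 3 ℕ.^ m) ℕ.+ 3 ℕ.* (length S′ ℕ.* 3 ℕ.^ m)
    ≤⟨ ℕ.+-mono-≤ (ℕ.*-monoʳ-≤ 3 (length-smallSubsets m (suc d)))
                  (ℕ.*-monoʳ-≤ 3 (length-smallSubsets m d)) ⟩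
  3 ℕ.* (4 ℕ.^ m ℕ.* (3 ℕ.* 3 ℕ.^ d)) ℕ.+ 3 ℕ.* (4 ℕ.^ m ℕ.* 3 ℕ.^ d)
    ≡⟨ solve 2 (λ f t → con 3 :* (f :* (con 3 :* t)) :+ con 3 :* (f :* t) :=
         con 4 :* f :* (con 3 :* t)) refl (4 ℕ.^ m) (3 ℕ.^ d) ⟩
  4 ℕ.* 4 ℕ.^ m ℕ.* (3 ℕ.* 3 ℕ.^ d) ∎
  where
  open ℕ.≤-Reasoning
  open ℕ.+-*-Solver
  S  = smallSubsets m (suc d)
  S′ = smallSubsets m d

bit : Bool → ℚ
bit true  = 1ℚ
bit false = 0ℚ

monomial : ∀ {m} → Subset m → Vec Bool m → ℚ
monomial []          []      = 1ℚ
monomial (true  ∷ S) (b ∷ x) = bit b ℚ.* monomial S x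
monomial (false ∷ S) (b ∷ x) = monomial S x

card-insert : ∀ {m} (S : Subset m) i → card (S [ i ]≔ inside) ℕ.≤ suc (card S)
card-insert (true  ∷ S) zero    = ℕ.n≤1+n _
card-insert (false ∷ S) zero    = ℕ.≤-refl
card-insert (true  ∷ S) (suc i) = s≤s (card-insert S i)
card-insert (false ∷ S) (suc i) = card-insert S i

bit-idem : ∀ b → bit b ℚ.* bit b ≡ bit b
bit-idem true  = refl
bit-idem false = refl

monomial-insert : ∀ {m} (S : Subset m) i x →
  monomial (S [ i ]≔ inside) x ≡ bit (lookup x i) ℚ.* monomial S x
monomial-insert (true ∷ S) zero (b ∷ x) = begin
  bit b ℚ.* monomial S x                  ≡⟨ cong (ℚ._* _) (bit-idem b) ⟨
  bit b ℚ.* bit b ℚ.* monomial S x        ≡⟨ ℚ.*-assoc (bit b) (bit b) _ ⟩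
  bit b ℚ.* (bit b ℚ.* monomial S x)      ∎
  where open ≡-Reasoning
monomial-insert (false ∷ S) zero (b ∷ x) = refl
monomial-insert (true  ∷ S) (suc i) (b ∷ x) = begin
  bit b ℚ.* monomial (S [ i ]≔ inside) x                ≡⟨ cong (bit b ℚ.*_) (monomial-insert S i x) ⟩
  bit b ℚ.* (bit (lookup x i) ℚ.* monomial S x)
    ≡⟨ solve 3 (λ b c s → b :* (c :* s) := c :* (b :* s)) refl (bit b) (bit (lookup x i)) (monomial S x) ⟩
  bit (lookup x i) ℚ.* (bit b ℚ.* monomial S x)         ∎
  where
  open ≡-Reasoning
  open +-*-Solver
monomial-insert (false ∷ S) (suc i) (b ∷ x) = monomial-insert S i x

hamming : ∀ {m} → Vec Bool m → Vec Bool m → ℕ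
hamming []          []          = 0
hamming (true  ∷ x) (true  ∷ y) = hamming x y
hamming (false ∷ x) (false ∷ y) = hamming x y
hamming (true  ∷ x) (false ∷ y) = suc (hamming x y)
hamming (false ∷ x) (true  ∷ y) = suc (hamming x y)

hamming-comm : ∀ {m} (x y : Vec Bool m) → hamming x y ≡ hamming y x
hamming-comm []          []          = refl
hamming-comm (true  ∷ x) (true  ∷ y) = hamming-comm x y
hamming-comm (false ∷ x) (false ∷ y) = hamming-comm x y
hamming-comm (true  ∷ x) (false ∷ y) = cong suc (hamming-comm x y)
hamming-comm (false ∷ x) (true  ∷ y) = cong suc (hamming-comm x y)

similarity : ∀ {m} → Vec Bool m → Vec Bool m → ℕ
similarity []          []          = 1
similarity (true  ∷ x) (true  ∷ y) = 3 ℕ.* similarity x y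
similarity (false ∷ x) (false ∷ y) = 3 ℕ.* similarity x y
similarity (true  ∷ x) (false ∷ y) = similarity x y
similarity (false ∷ x) (true  ∷ y) = similarity x y

similarity*3^hamming : ∀ {m} (x y : Vec Bool m) → similarity x y ℕ.* 3 ℕ.^ hamming x y ≡ 3 ℕ.^ m
similarity*3^hamming []          []          = refl
similarity*3^hamming (true  ∷ x) (true  ∷ y) =
  trans (ℕ.*-assoc 3 (similarity x y) _) (cong (3 ℕ.*_) (similarity*3^hamming x y))
similarity*3^hamming (false ∷ x) (false ∷ y) =
  trans (ℕ.*-assoc 3 (similarity x y) _) (cong (3 ℕ.*_) (similarity*3^hamming x y))
similarity*3^hamming (true  ∷ x) (false ∷ y) =
  trans (solve 2 (λ s h → s :* (con 3 :* h) := con 3 :* (s :* h)) refl (similarity x y) (3 ℕ.^ hamming x y))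
    (cong (3 ℕ.*_) (similarity*3^hamming x y))
  where open ℕ.+-*-Solver
similarity*3^hamming (false ∷ x) (true  ∷ y) =
  trans (solve 2 (λ s h → s :* (con 3 :* h) := con 3 :* (s :* h)) refl (similarity x y) (3 ℕ.^ hamming x y))
    (cong (3 ℕ.*_) (similarity*3^hamming x y))
  where open ℕ.+-*-Solver

sumCube : ∀ {m} → (Vec Bool m → ℕ) → ℕ
sumCube {zero}  f = f []
sumCube {suc m} f = sumCube (f ∘ (true ∷_)) ℕ.+ sumCube (f ∘ (false ∷_))

sumCube-const : ∀ m c → sumCube {m} (λ _ → c) ≡ 2 ℕ.^ m ℕ.* c
sumCube-const zero    c = sym (ℕ.*-identityˡ c)
sumCube-const (suc m) c = trans (cong₂ ℕ._+_ (sumCube-const m c) (sumCube-const m c))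
  (solve 2 (λ t c → t :* c :+ t :* c := con 2 :* t :* c) refl (2 ℕ.^ m) c)
  where open ℕ.+-*-Solver

sumCube-+ : ∀ {m} (f g : Vec Bool m → ℕ) → sumCube (λ y → f y ℕ.+ g y) ≡ sumCube f ℕ.+ sumCube g
sumCube-+ {zero}  f g = refl
sumCube-+ {suc m} f g = trans
  (cong₂ ℕ._+_ (sumCube-+ (f ∘ (true ∷_)) (g ∘ (true ∷_))) (sumCube-+ (f ∘ (false ∷_)) (g ∘ (false ∷_))))
  (solve 4 (λ a b c d → (a :+ b) :+ (c :+ d) := (a :+ c) :+ (b :+ d)) refl
    (sumCube (f ∘ (true ∷_))) (sumCube (g ∘ (true ∷_))) (sumCube (f ∘ (false ∷_))) (sumCube (g ∘ (false ∷_))))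
  where open ℕ.+-*-Solver

sumCube-* : ∀ {m} c (f : Vec Bool m → ℕ) → sumCube (λ y → c ℕ.* f y) ≡ c ℕ.* sumCube f
sumCube-* {zero}  c f = refl
sumCube-* {suc m} c f = trans (cong₂ ℕ._+_ (sumCube-* c (f ∘ (true ∷_))) (sumCube-* c (f ∘ (false ∷_))))
  (sym (ℕ.*-distribˡ-+ c (sumCube (f ∘ (true ∷_))) (sumCube (f ∘ (false ∷_)))))

sumCube-< : ∀ {m} (f g : Vec Bool m → ℕ) → sumCube f ℕ.< sumCube g → ∃ λ y → f y ℕ.< g y
sumCube-< {zero}  f g f<g = [] , f<g
sumCube-< {suc m} f g f<g
  with sumCube (f ∘ (true ∷_)) ℕ.<? sumCube (g ∘ (true ∷_))
     | sumCube (f ∘ (false ∷_)) ℕ.<? sumCube (g ∘ (false ∷_))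
... | yes f₁<g₁ | _ = let y , fy<gy = sumCube-< _ _ f₁<g₁ in true ∷ y , fy<gy
... | no _      | yes f₀<g₀ = let y , fy<gy = sumCube-< _ _ f₀<g₀ in false ∷ y , fy<gy
... | no f₁≮g₁  | no f₀≮g₀ =
  contradiction f<g (ℕ.≤⇒≯ (ℕ.+-mono-≤ (ℕ.≮⇒≥ f₁≮g₁) (ℕ.≮⇒≥ f₀≮g₀)))

sumCube-similarity : ∀ {m} (x : Vec Bool m) → sumCube (similarity x) ≡ 4 ℕ.^ m
sumCube-similarity []          = refl
sumCube-similarity {suc m} (true ∷ x) = trans
  (cong₂ ℕ._+_ (trans (sumCube-* 3 (similarity x)) (cong (3 ℕ.*_) (sumCube-similarity x)))
               (sumCube-similarity x))
  (solve 1 (λ f → con 3 :* f :+ f := con 4 :* f) refl (4 ℕ.^ m))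
  where open ℕ.+-*-Solver
sumCube-similarity {suc m} (false ∷ x) = trans
  (cong₂ ℕ._+_ (sumCube-similarity x)
               (trans (sumCube-* 3 (similarity x)) (cong (3 ℕ.*_) (sumCube-similarity x))))
  (solve 1 (λ f → f :+ con 3 :* f := con 4 :* f) refl (4 ℕ.^ m))
  where open ℕ.+-*-Solver

totalSimilarity : ∀ {m N} → (Fin N → Vec Bool m) → Vec Bool m → ℕ
totalSimilarity {N = zero}  c y = 0
totalSimilarity {N = suc N} c y = similarity (c zero) y ℕ.+ totalSimilarity (c ∘ suc) y

similarity≤total : ∀ {m N} (c : Fin N → Vec Bool m) y a → similarity (c a) y ℕ.≤ totalSimilarity c y
similarity≤total c y zero    = ℕ.m≤m+n _ _
similarity≤total c y (suc a) = ℕ.≤-trans (similarity≤total (c ∘ suc) y a) (ℕ.m≤n+m _ _)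

sumCube-totalSimilarity : ∀ {m N} (c : Fin N → Vec Bool m) → sumCube (totalSimilarity c) ≡ N ℕ.* 4 ℕ.^ m
sumCube-totalSimilarity {m} {zero}  c = trans (sumCube-const m 0) (ℕ.*-zeroʳ (2 ℕ.^ m))
sumCube-totalSimilarity {m} {suc N} c = trans (sumCube-+ (similarity (c zero)) (totalSimilarity (c ∘ suc)))
  (cong₂ ℕ._+_ (sumCube-similarity (c zero)) (sumCube-totalSimilarity (c ∘ suc)))

-- An exponential moment replaces the volume of a Hamming ball.
far-word : ∀ {m N} k (c : Fin N → Vec Bool m) → 3 ℕ.^ k ℕ.* (N ℕ.* 4 ℕ.^ m) ℕ.< 2 ℕ.^ m ℕ.* 3 ℕ.^ m →
  ∃ λ y → ∀ a → k ℕ.< hamming (c a) y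
far-word {m} {N} k c bound = let y , y< = sumCube-< f (λ _ → 3 ℕ.^ m) sum-f< in
  y , λ a → ℕ.≰⇒> λ h≤k → ℕ.<⇒≱ y< (begin
    3 ℕ.^ m                                        ≡⟨ similarity*3^hamming (c a) y ⟨
    similarity (c a) y ℕ.* 3 ℕ.^ hamming (c a) y
      ≤⟨ ℕ.*-mono-≤ (similarity≤total c y a) (ℕ.^-monoʳ-≤ 3 h≤k) ⟩
    totalSimilarity c y ℕ.* 3 ℕ.^ k                ≡⟨ ℕ.*-comm (totalSimilarity c y) (3 ℕ.^ k) ⟩
    3 ℕ.^ k ℕ.* totalSimilarity c y                ∎)
  where
  open ℕ.≤-Reasoning
  f : Vec Bool m → ℕ
  f y = 3 ℕ.^ k ℕ.* totalSimilarity c y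

  sum-f< : sumCube f ℕ.< sumCube {m} (λ _ → 3 ℕ.^ m)
  sum-f< = subst₂ ℕ._<_
    (sym (trans (sumCube-* (3 ℕ.^ k) (totalSimilarity c)) (cong (3 ℕ.^ k ℕ.*_) (sumCube-totalSimilarity c))))
    (sym (sumCube-const m (3 ℕ.^ m))) bound

-- The greedy (Gilbert–Varshamov) construction.
code-exists : ∀ m k E → 3 ℕ.^ k ℕ.* (E ℕ.* 4 ℕ.^ m) ℕ.< 2 ℕ.^ m ℕ.* 3 ℕ.^ m →
  ∃ λ (c : Fin (suc E) → Vec Bool m) → ∀ a b → a ≢ b → k ℕ.< hamming (c a) (c b)
code-exists m k E bound = extend (smaller E bound)
  where
  extend : ∀ {N} → (∃ λ (c : Fin N → Vec Bool m) → (∀ a b → a ≢ b → k ℕ.< hamming (c a) (c b)) ×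
      3 ℕ.^ k ℕ.* (N ℕ.* 4 ℕ.^ m) ℕ.< 2 ℕ.^ m ℕ.* 3 ℕ.^ m) →
    ∃ λ (c : Fin (suc N) → Vec Bool m) → ∀ a b → a ≢ b → k ℕ.< hamming (c a) (c b)
  extend {N} (c , c-far , bound) = let y , y-far = far-word k c bound in c′ y , c′-far y y-far
    where
    c′ : Vec Bool m → Fin (suc N) → Vec Bool m
    c′ y zero    = y
    c′ y (suc a) = c a

    c′-far : ∀ y → (∀ a → k ℕ.< hamming (c a) y) → ∀ a b → a ≢ b → k ℕ.< hamming (c′ y a) (c′ y b)
    c′-far y y-far zero    zero    a≢b = contradiction refl a≢b
    c′-far y y-far zero    (suc b) a≢b = subst (k ℕ.<_) (hamming-comm (c b) y) (y-far b)
    c′-far y y-far (suc a) zero    a≢b = y-far a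
    c′-far y y-far (suc a) (suc b) a≢b = c-far a b (a≢b ∘ cong suc)

  smaller : ∀ N → 3 ℕ.^ k ℕ.* (N ℕ.* 4 ℕ.^ m) ℕ.< 2 ℕ.^ m ℕ.* 3 ℕ.^ m →
    ∃ λ (c : Fin N → Vec Bool m) → (∀ a b → a ≢ b → k ℕ.< hamming (c a) (c b)) ×
      3 ℕ.^ k ℕ.* (N ℕ.* 4 ℕ.^ m) ℕ.< 2 ℕ.^ m ℕ.* 3 ℕ.^ m
  smaller zero    bound = (λ ()) , (λ ()) , bound
  smaller (suc N) bound =
    let c , c-far = extend (smaller N (ℕ.≤-<-trans
          (ℕ.*-monoʳ-≤ (3 ℕ.^ k) (ℕ.*-monoˡ-≤ (4 ℕ.^ m) (ℕ.n≤1+n N))) bound))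
    in c , c-far , bound

-- Words as weights

ℕ→ℚ : ℕ → ℚ
ℕ→ℚ n = + n / 1

2ℚ 3ℚ 4ℚ : ℚ
2ℚ = + 2 / 1
3ℚ = + 3 / 1
4ℚ = + 4 / 1

ℕ→ℚ-+ : ∀ m n → ℕ→ℚ (m ℕ.+ n) ≡ ℕ→ℚ m ℚ.+ ℕ→ℚ n
ℕ→ℚ-+ m n = ℚ.toℚᵘ-injective (begin
  ℚ.toℚᵘ (ℕ→ℚ (m ℕ.+ n))                      ≈⟨ ℚ.toℚᵘ-fromℚᵘ (ℚᵘ.mkℚᵘ (+ (m ℕ.+ n)) 0) ⟩
  ℚᵘ.mkℚᵘ (+ (m ℕ.+ n)) 0
    ≈⟨ ℚᵘ.*≡* (cong (ℤ._* (+ 1)) (sym (cong₂ ℤ._+_ (ℤ.*-identityʳ (+ m)) (ℤ.*-identityʳ (+ n))))) ⟩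
  ℚᵘ.mkℚᵘ (+ m) 0 ℚᵘ.+ ℚᵘ.mkℚᵘ (+ n) 0
    ≈⟨ ℚᵘ.+-cong (ℚ.toℚᵘ-fromℚᵘ (ℚᵘ.mkℚᵘ (+ m) 0)) (ℚ.toℚᵘ-fromℚᵘ (ℚᵘ.mkℚᵘ (+ n) 0)) ⟨
  ℚ.toℚᵘ (ℕ→ℚ m) ℚᵘ.+ ℚ.toℚᵘ (ℕ→ℚ n)          ≈⟨ ℚ.toℚᵘ-homo-+ (ℕ→ℚ m) (ℕ→ℚ n) ⟨
  ℚ.toℚᵘ (ℕ→ℚ m ℚ.+ ℕ→ℚ n)                    ∎)
  where open ℚᵘ.≃-Reasoning

ℕ→ℚ-* : ∀ m n → ℕ→ℚ (m ℕ.* n) ≡ ℕ→ℚ m ℚ.* ℕ→ℚ n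
ℕ→ℚ-* zero    n = sym (ℚ.*-zeroˡ (ℕ→ℚ n))
ℕ→ℚ-* (suc m) n = begin
  ℕ→ℚ (n ℕ.+ m ℕ.* n)                 ≡⟨ ℕ→ℚ-+ n (m ℕ.* n) ⟩
  ℕ→ℚ n ℚ.+ ℕ→ℚ (m ℕ.* n)             ≡⟨ cong (ℕ→ℚ n ℚ.+_) (ℕ→ℚ-* m n) ⟩
  ℕ→ℚ n ℚ.+ ℕ→ℚ m ℚ.* ℕ→ℚ n
    ≡⟨ solve 2 (λ m n → n :+ m :* n := (con 1ℚ :+ m) :* n) refl (ℕ→ℚ m) (ℕ→ℚ n) ⟩
  (1ℚ ℚ.+ ℕ→ℚ m) ℚ.* ℕ→ℚ n            ≡⟨ cong (ℚ._* ℕ→ℚ n) (ℕ→ℚ-+ 1 m) ⟨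
  ℕ→ℚ (suc m) ℚ.* ℕ→ℚ n               ∎
  where
  open ≡-Reasoning
  open +-*-Solver

0≤ℕ→ℚ : ∀ n → 0ℚ ℚ.≤ ℕ→ℚ n
0≤ℕ→ℚ n = ℚ.nonNegative⁻¹ (ℕ→ℚ n) {{ℚ.normalize-nonNeg n 1}}

ℕ→ℚ-mono-≤ : ∀ {m n} → m ℕ.≤ n → ℕ→ℚ m ℚ.≤ ℕ→ℚ n
ℕ→ℚ-mono-≤ {m} {n} m≤n = subst (ℕ→ℚ m ℚ.≤_)
  (trans (sym (ℕ→ℚ-+ m (n ℕ.∸ m))) (cong ℕ→ℚ (ℕ.m+[n∸m]≡n m≤n)))
  (p≤p+q (ℕ→ℚ m) (0≤ℕ→ℚ (n ℕ.∸ m)))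

sum-const : ∀ n c → sum {n} (λ _ → c) ≡ ℕ→ℚ n ℚ.* c
sum-const zero    c = sym (ℚ.*-zeroˡ c)
sum-const (suc n) c = begin
  c ℚ.+ sum {n} (λ _ → c)        ≡⟨ cong (c ℚ.+_) (sum-const n c) ⟩
  c ℚ.+ ℕ→ℚ n ℚ.* c              ≡⟨ solve 2 (λ n c → c :+ n :* c := (con 1ℚ :+ n) :* c) refl (ℕ→ℚ n) c ⟩
  (1ℚ ℚ.+ ℕ→ℚ n) ℚ.* c           ≡⟨ cong (ℚ._* c) (ℕ→ℚ-+ 1 n) ⟨
  ℕ→ℚ (suc n) ℚ.* c              ∎
  where
  open ≡-Reasoning
  open +-*-Solver

-- Each bit is encoded by two points of weights 3, 1 or 1, 3, so that the total
-- weight does not depend on the word; r points of weight 2 are left over.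
weight : ∀ {m} r → Vec Bool m → Fin (m ℕ.* 2 ℕ.+ r) → ℚ
weight r []          _             = 2ℚ
weight r (true  ∷ x) zero          = 3ℚ
weight r (true  ∷ x) (suc zero)    = 1ℚ
weight r (false ∷ x) zero          = 1ℚ
weight r (false ∷ x) (suc zero)    = 3ℚ
weight r (_     ∷ x) (suc (suc i)) = weight r x i

1≤weight : ∀ {m} r (x : Vec Bool m) i → 1ℚ ℚ.≤ weight r x i
1≤weight r []          i             = toWitness {a? = 1ℚ ℚ.≤? 2ℚ} _
1≤weight r (true  ∷ x) zero          = toWitness {a? = 1ℚ ℚ.≤? 3ℚ} _
1≤weight r (true  ∷ x) (suc zero)    = ℚ.≤-refl
1≤weight r (false ∷ x) zero          = ℚ.≤-refl
1≤weight r (false ∷ x) (suc zero)    = toWitness {a? = 1ℚ ℚ.≤? 3ℚ} _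
1≤weight r (true  ∷ x) (suc (suc i)) = 1≤weight r x i
1≤weight r (false ∷ x) (suc (suc i)) = 1≤weight r x i

weight≤3 : ∀ {m} r (x : Vec Bool m) i → weight r x i ℚ.≤ 3ℚ
weight≤3 r []          i             = toWitness {a? = 2ℚ ℚ.≤? 3ℚ} _
weight≤3 r (true  ∷ x) zero          = ℚ.≤-refl
weight≤3 r (true  ∷ x) (suc zero)    = toWitness {a? = 1ℚ ℚ.≤? 3ℚ} _
weight≤3 r (false ∷ x) zero          = toWitness {a? = 1ℚ ℚ.≤? 3ℚ} _
weight≤3 r (false ∷ x) (suc zero)    = ℚ.≤-refl
weight≤3 r (true  ∷ x) (suc (suc i)) = weight≤3 r x i
weight≤3 r (false ∷ x) (suc (suc i)) = weight≤3 r x i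

sum-weight : ∀ {m} r (x : Vec Bool m) → sum (weight r x) ≡ sum {m ℕ.* 2 ℕ.+ r} (λ _ → 2ℚ)
sum-weight r []          = refl
sum-weight {suc m} r (true  ∷ x) = trans (cong (λ s → 3ℚ ℚ.+ (1ℚ ℚ.+ s)) (sum-weight r x))
  (solve 1 (λ s → con 3ℚ :+ (con 1ℚ :+ s) := con 2ℚ :+ (con 2ℚ :+ s)) refl (sum {m ℕ.* 2 ℕ.+ r} (λ _ → 2ℚ)))
  where open +-*-Solver
sum-weight {suc m} r (false ∷ x) = trans (cong (λ s → 1ℚ ℚ.+ (3ℚ ℚ.+ s)) (sum-weight r x))
  (solve 1 (λ s → con 1ℚ :+ (con 3ℚ :+ s) := con 2ℚ :+ (con 2ℚ :+ s)) refl (sum {m ℕ.* 2 ℕ.+ r} (λ _ → 2ℚ)))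
  where open +-*-Solver

distance : ∀ {n} → (Fin n → ℚ) → (Fin n → ℚ) → ℚ
distance f g = sum λ i → ℚ.∣ f i ℚ.- g i ∣

distance-weight : ∀ {m} r (x y : Vec Bool m) → distance (weight r x) (weight r y) ≡ ℕ→ℚ (hamming x y) ℚ.* 4ℚ
distance-weight r [] [] = sum-zero {r} λ _ → refl
distance-weight r (true  ∷ x) (true  ∷ y) = trans (cong (λ s → 0ℚ ℚ.+ (0ℚ ℚ.+ s)) (distance-weight r x y))
  (solve 1 (λ s → con 0ℚ :+ (con 0ℚ :+ s) := s) refl (ℕ→ℚ (hamming x y) ℚ.* 4ℚ))
  where open +-*-Solver
distance-weight r (false ∷ x) (false ∷ y) = trans (cong (λ s → 0ℚ ℚ.+ (0ℚ ℚ.+ s)) (distance-weight r x y))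
  (solve 1 (λ s → con 0ℚ :+ (con 0ℚ :+ s) := s) refl (ℕ→ℚ (hamming x y) ℚ.* 4ℚ))
  where open +-*-Solver
distance-weight r (true  ∷ x) (false ∷ y) = trans (cong (λ s → 2ℚ ℚ.+ (2ℚ ℚ.+ s)) (distance-weight r x y))
  (trans (solve 1 (λ h → con 2ℚ :+ (con 2ℚ :+ h :* con 4ℚ) := (con 1ℚ :+ h) :* con 4ℚ) refl
       (ℕ→ℚ (hamming x y)))
    (cong (ℚ._* 4ℚ) (sym (ℕ→ℚ-+ 1 (hamming x y)))))
  where open +-*-Solver
distance-weight r (false ∷ x) (true  ∷ y) = trans (cong (λ s → 2ℚ ℚ.+ (2ℚ ℚ.+ s)) (distance-weight r x y))
  (trans (solve 1 (λ h → con 2ℚ :+ (con 2ℚ :+ h :* con 4ℚ) := (con 1ℚ :+ h) :* con 4ℚ) refl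
       (ℕ→ℚ (hamming x y)))
    (cong (ℚ._* 4ℚ) (sym (ℕ→ℚ-+ 1 (hamming x y)))))
  where open +-*-Solver

weight-affine : ∀ {m} r (i : Fin (m ℕ.* 2 ℕ.+ r)) →
  (∀ (x : Vec Bool m) → weight r x i ≡ 2ℚ) ⊎
  (∃ λ j → ∃ λ α → ∃ λ β → ∀ (x : Vec Bool m) → weight r x i ≡ α ℚ.+ β ℚ.* bit (lookup x j))
weight-affine {zero}  r i          = inj₁ λ where [] → refl
weight-affine {suc m} r zero       = inj₂ (zero , 1ℚ , 2ℚ , λ where
  (true  ∷ x) → refl
  (false ∷ x) → refl)
weight-affine {suc m} r (suc zero) = inj₂ (zero , 3ℚ , ℚ.- 2ℚ , λ where
  (true  ∷ x) → refl
  (false ∷ x) → refl)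
weight-affine {suc m} r (suc (suc i)) with weight-affine r i
... | inj₁ const           = inj₁ λ where
  (true  ∷ x) → const x
  (false ∷ x) → const x
... | inj₂ (j , α , β , affine) = inj₂ (suc j , α , β , λ where
  (true  ∷ x) → affine x
  (false ∷ x) → affine x)

weightProduct : ∀ {n} → (Fin n → ℚ) → List (Fin n) → ℚ
weightProduct w []      = 1ℚ
weightProduct w (i ∷ M) = w i ℚ.* weightProduct w M

monomial-∅ : ∀ {m} (x : Vec Bool m) → monomial ⊥ x ≡ 1ℚ
monomial-∅ []      = refl
monomial-∅ (b ∷ x) = monomial-∅ x

-- A weight is an affine function of one bit, so a product of d weights is a
-- polynomial of degree at most d in the bits.
weightProduct-null : ∀ {m N} r d (c : Fin N → Vec Bool m) (z : Fin N → ℚ) →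
  (∀ S → card S ℕ.≤ d → sum (λ a → z a ℚ.* monomial S (c a)) ≡ 0ℚ) →
  ∀ M S → card S ℕ.+ length M ℕ.≤ d →
  sum (λ a → z a ℚ.* (monomial S (c a) ℚ.* weightProduct (weight r (c a)) M)) ≡ 0ℚ
weightProduct-null r d c z z-null [] S ∣S∣≤d = trans
  (sum-cong-≗ λ a → cong (z a ℚ.*_) (ℚ.*-identityʳ (monomial S (c a))))
  (z-null S (subst (ℕ._≤ d) (ℕ.+-identityʳ (card S)) ∣S∣≤d))
weightProduct-null r d c z z-null (i ∷ M) S ≤d = go (weight-affine r i)
  where
  open ≡-Reasoning
  open +-*-Solver

  P : _ → ℚ
  P a = weightProduct (weight r (c a)) M

  ≤d′ : suc (card S ℕ.+ length M) ℕ.≤ d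
  ≤d′ = subst (ℕ._≤ d) (ℕ.+-suc (card S) (length M)) ≤d

  tail-null : sum (λ a → z a ℚ.* (monomial S (c a) ℚ.* P a)) ≡ 0ℚ
  tail-null = weightProduct-null r d c z z-null M S (ℕ.≤-trans (ℕ.n≤1+n _) ≤d′)

  go : _ → sum (λ a → z a ℚ.* (monomial S (c a) ℚ.* (weight r (c a) i ℚ.* P a))) ≡ 0ℚ
  go (inj₁ const) = begin
    sum (λ a → z a ℚ.* (monomial S (c a) ℚ.* (weight r (c a) i ℚ.* P a)))
      ≡⟨ sum-cong-≗ (λ a → trans (cong (λ w → z a ℚ.* (monomial S (c a) ℚ.* (w ℚ.* P a))) (const (c a)))
           (solve 4 (λ z s w p → z :* (s :* (w :* p)) := w :* (z :* (s :* p))) refl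
                (z a) (monomial S (c a)) 2ℚ (P a))) ⟩
    sum (λ a → 2ℚ ℚ.* (z a ℚ.* (monomial S (c a) ℚ.* P a)))
      ≡⟨ *-distribˡ-sum 2ℚ (λ a → z a ℚ.* (monomial S (c a) ℚ.* P a)) ⟨
    2ℚ ℚ.* sum (λ a → z a ℚ.* (monomial S (c a) ℚ.* P a))
      ≡⟨ cong (2ℚ ℚ.*_) tail-null ⟩
    0ℚ ∎
  go (inj₂ (j , α , β , affine)) = begin
    sum (λ a → z a ℚ.* (monomial S (c a) ℚ.* (weight r (c a) i ℚ.* P a)))
      ≡⟨ sum-cong-≗ (λ a → trans (cong (λ w → z a ℚ.* (monomial S (c a) ℚ.* (w ℚ.* P a))) (affine (c a)))
           (trans (solve 6 (λ z s α β x p → z :* (s :* ((α :+ β :* x) :* p)) :=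
                α :* (z :* (s :* p)) :+ β :* (z :* ((x :* s) :* p))) refl
                (z a) (monomial S (c a)) α β (bit (lookup (c a) j)) (P a))
             (cong (λ s → α ℚ.* (z a ℚ.* (monomial S (c a) ℚ.* P a)) ℚ.+ β ℚ.* (z a ℚ.* (s ℚ.* P a)))
               (sym (monomial-insert S j (c a)))))) ⟩
    sum (λ a → α ℚ.* (z a ℚ.* (monomial S (c a) ℚ.* P a)) ℚ.+
               β ℚ.* (z a ℚ.* (monomial (S [ j ]≔ true) (c a) ℚ.* P a)))
      ≡⟨ ∑-distrib-+ (λ a → α ℚ.* (z a ℚ.* (monomial S (c a) ℚ.* P a))) _ ⟩
    sum (λ a → α ℚ.* (z a ℚ.* (monomial S (c a) ℚ.* P a))) ℚ.+
    sum (λ a → β ℚ.* (z a ℚ.* (monomial (S [ j ]≔ true) (c a) ℚ.* P a)))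
      ≡⟨ cong₂ ℚ._+_ (*-distribˡ-sum α (λ a → z a ℚ.* (monomial S (c a) ℚ.* P a)))
                     (*-distribˡ-sum β (λ a → z a ℚ.* (monomial (S [ j ]≔ true) (c a) ℚ.* P a))) ⟨
    α ℚ.* sum (λ a → z a ℚ.* (monomial S (c a) ℚ.* P a)) ℚ.+
    β ℚ.* sum (λ a → z a ℚ.* (monomial (S [ j ]≔ true) (c a) ℚ.* P a))
      ≡⟨ cong₂ (λ s t → α ℚ.* s ℚ.+ β ℚ.* t) tail-null
           (weightProduct-null r d c z z-null M (S [ j ]≔ true)
             (ℕ.≤-trans (ℕ.+-monoˡ-≤ (length M) (card-insert S j)) ≤d′)) ⟩
    α ℚ.* 0ℚ ℚ.+ β ℚ.* 0ℚ
      ≡⟨ solve 2 (λ α β → α :* con 0ℚ :+ β :* con 0ℚ := con 0ℚ) refl α β ⟩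
    0ℚ ∎

record HardFamily (n d : ℕ) : Set where
  field
    size         : ℕ
    weights      : Fin size → Fin n → ℚ
    1≤weights    : ∀ a i → 1ℚ ℚ.≤ weights a i
    weights≤3    : ∀ a i → weights a i ℚ.≤ 3ℚ
    sum-weights  : ∀ a → sum (weights a) ≡ sum {n} (λ _ → 2ℚ)
    separated    : ∀ a b → a ≢ b → (+ 1 / 40) ℚ.* sum {n} (λ _ → 2ℚ) ℚ.≤ distance (weights a) (weights b)
    coeff        : Fin size → ℚ
    coeff≢0      : ∃ λ a → coeff a ≢ 0ℚ
    coeff-null   : ∀ M → length M ℕ.≤ d → sum (λ a → coeff a ℚ.* weightProduct (weights a) M) ≡ 0ℚ

^-distribʳ-* : ∀ o m n → (m ℕ.* n) ℕ.^ o ≡ m ℕ.^ o ℕ.* n ℕ.^ o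
^-distribʳ-* zero    m n = refl
^-distribʳ-* (suc o) m n = trans (cong (m ℕ.* n ℕ.*_) (^-distribʳ-* o m n))
  (solve 4 (λ m n p q → m :* n :* (p :* q) := m :* p :* (n :* q)) refl m n (m ℕ.^ o) (n ℕ.^ o))
  where open ℕ.+-*-Solver

code-bound : ∀ l k .{{_ : ℕ.NonZero k}} → 9 ℕ.* 16 ℕ.^ l ℕ.< 18 ℕ.^ l → let m = l ℕ.* k in
  3 ℕ.^ k ℕ.* (length (smallSubsets m k) ℕ.* 4 ℕ.^ m) ℕ.< 2 ℕ.^ m ℕ.* 3 ℕ.^ m
code-bound l k 9*16^l<18^l = ℕ.*-cancelʳ-< (3 ℕ.^ m) _ _ (begin-strict
  3 ℕ.^ k ℕ.* (E ℕ.* 4 ℕ.^ m) ℕ.* 3 ℕ.^ m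
    ≡⟨ solve 4 (λ t e f s → t :* (e :* f) :* s := t :* f :* (e :* s)) refl (3 ℕ.^ k) E (4 ℕ.^ m) (3 ℕ.^ m) ⟩
  3 ℕ.^ k ℕ.* 4 ℕ.^ m ℕ.* (E ℕ.* 3 ℕ.^ m)
    ≤⟨ ℕ.*-monoʳ-≤ (3 ℕ.^ k ℕ.* 4 ℕ.^ m) (length-smallSubsets m k) ⟩
  3 ℕ.^ k ℕ.* 4 ℕ.^ m ℕ.* (4 ℕ.^ m ℕ.* 3 ℕ.^ k)
    ≡⟨ solve 2 (λ t f → t :* f :* (f :* t) := (t :* t) :* (f :* f)) refl (3 ℕ.^ k) (4 ℕ.^ m) ⟩
  (3 ℕ.^ k ℕ.* 3 ℕ.^ k) ℕ.* (4 ℕ.^ m ℕ.* 4 ℕ.^ m)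
    ≡⟨ cong₂ ℕ._*_ (^-distribʳ-* k 3 3) (^-distribʳ-* m 4 4) ⟨
  9 ℕ.^ k ℕ.* 16 ℕ.^ m
    ≡⟨ cong (9 ℕ.^ k ℕ.*_) (ℕ.^-*-assoc 16 l k) ⟨
  9 ℕ.^ k ℕ.* (16 ℕ.^ l) ℕ.^ k
    ≡⟨ ^-distribʳ-* k 9 (16 ℕ.^ l) ⟨
  (9 ℕ.* 16 ℕ.^ l) ℕ.^ k
    <⟨ ℕ.^-monoˡ-< k 9*16^l<18^l ⟩
  (18 ℕ.^ l) ℕ.^ k
    ≡⟨ ℕ.^-*-assoc 18 l k ⟩
  18 ℕ.^ m
    ≡⟨ trans (^-distribʳ-* m 6 3) (cong (ℕ._* 3 ℕ.^ m) (^-distribʳ-* m 2 3)) ⟩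
  2 ℕ.^ m ℕ.* 3 ℕ.^ m ℕ.* 3 ℕ.^ m ∎)
  where
  open ℕ.≤-Reasoning
  open ℕ.+-*-Solver
  m = l ℕ.* k
  E = length (smallSubsets m k)

hardFamily : ∀ m k r → 3 ℕ.^ k ℕ.* (length (smallSubsets m k) ℕ.* 4 ℕ.^ m) ℕ.< 2 ℕ.^ m ℕ.* 3 ℕ.^ m →
  m ℕ.* 2 ℕ.+ r ℕ.≤ 80 ℕ.* k → HardFamily (m ℕ.* 2 ℕ.+ r) k
hardFamily m k r bound n≤80k with code-exists m k (length (smallSubsets m k)) bound
... | c , c-far with kernel-nontrivial ℕ.≤-refl (λ e a → monomial (List.lookup (smallSubsets m k) e) (c a))
... | z , z≢0 , z-null = record
  { size        = suc (length (smallSubsets m k))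
  ; weights     = weight r ∘ c
  ; 1≤weights   = 1≤weight r ∘ c
  ; weights≤3   = weight≤3 r ∘ c
  ; sum-weights = sum-weight r ∘ c
  ; separated   = separated
  ; coeff       = z
  ; coeff≢0     = z≢0
  ; coeff-null  = λ M ∣M∣≤k → trans
      (sum-cong-≗ λ a → cong (z a ℚ.*_) (sym (trans
        (cong (ℚ._* weightProduct (weight r (c a)) M) (monomial-∅ (c a)))
        (ℚ.*-identityˡ (weightProduct (weight r (c a)) M)))))
      (weightProduct-null r k c z monomials-null M ⊥
        (subst (λ s → s ℕ.+ length M ℕ.≤ k) (sym (∣⊥∣≡0 m)) ∣M∣≤k))
  }
  where
  n = m ℕ.* 2 ℕ.+ r

  monomials-null : ∀ S → card S ℕ.≤ k → sum (λ a → z a ℚ.* monomial S (c a)) ≡ 0ℚ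
  monomials-null S ∣S∣≤k =
    subst (λ T → sum (λ a → z a ℚ.* monomial T (c a)) ≡ 0ℚ) (sym (lookup-index S∈)) (z-null (index S∈))
    where S∈ = ∈-smallSubsets S ∣S∣≤k

  separated : ∀ a b → a ≢ b →
    (+ 1 / 40) ℚ.* sum {n} (λ _ → 2ℚ) ℚ.≤ distance (weight r (c a)) (weight r (c b))
  separated a b a≢b = begin
    (+ 1 / 40) ℚ.* sum {n} (λ _ → 2ℚ)         ≡⟨ cong ((+ 1 / 40) ℚ.*_) (sum-const n 2ℚ) ⟩
    (+ 1 / 40) ℚ.* (ℕ→ℚ n ℚ.* 2ℚ)
      ≡⟨ solve 1 (λ n → con (+ 1 / 40) :* (n :* con 2ℚ) := n :* con (+ 1 / 20)) refl (ℕ→ℚ n) ⟩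
    ℕ→ℚ n ℚ.* (+ 1 / 20)                      ≤⟨ ℚ.*-monoʳ-≤-nonNeg (+ 1 / 20) (ℕ→ℚ-mono-≤ n≤80k) ⟩
    ℕ→ℚ (80 ℕ.* k) ℚ.* (+ 1 / 20)             ≡⟨ cong (ℚ._* (+ 1 / 20)) (ℕ→ℚ-* 80 k) ⟩
    (+ 80 / 1) ℚ.* ℕ→ℚ k ℚ.* (+ 1 / 20)
      ≡⟨ solve 1 (λ k → con (+ 80 / 1) :* k :* con (+ 1 / 20) := k :* con 4ℚ) refl (ℕ→ℚ k) ⟩
    ℕ→ℚ k ℚ.* 4ℚ                              ≤⟨ ℚ.*-monoʳ-≤-nonNeg 4ℚ (ℕ→ℚ-mono-≤ (ℕ.<⇒≤ (c-far a b a≢b))) ⟩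
    ℕ→ℚ (hamming (c a) (c b)) ℚ.* 4ℚ          ≡⟨ distance-weight r (c a) (c b) ⟨
    distance (weight r (c a)) (weight r (c b)) ∎
    where
    open ℚ.≤-Reasoning
    open +-*-Solver

9*16^20<18^20 : 9 ℕ.* 16 ℕ.^ 20 ℕ.< 18 ℕ.^ 20
9*16^20<18^20 = ℕ.<ᵇ⇒< (9 ℕ.* 16 ℕ.^ 20) (18 ℕ.^ 20) _

hardFamily-20 : ∀ k .{{_ : ℕ.NonZero k}} r → r ℕ.≤ 40 → HardFamily (20 ℕ.* k ℕ.* 2 ℕ.+ r) k
hardFamily-20 k r r≤40 = hardFamily (20 ℕ.* k) k r (code-bound 20 k 9*16^20<18^20) (begin
  20 ℕ.* k ℕ.* 2 ℕ.+ r               ≤⟨ ℕ.+-monoʳ-≤ (20 ℕ.* k ℕ.* 2) r≤40 ⟩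
  20 ℕ.* k ℕ.* 2 ℕ.+ 40              ≤⟨ ℕ.+-monoʳ-≤ (20 ℕ.* k ℕ.* 2) (ℕ.m≤m*n 40 k) ⟩
  20 ℕ.* k ℕ.* 2 ℕ.+ 40 ℕ.* k
    ≡⟨ solve 1 (λ k → con 20 :* k :* con 2 :+ con 40 :* k := con 80 :* k) refl k ⟩
  80 ℕ.* k                           ∎)
  where
  open ℕ.≤-Reasoning
  open ℕ.+-*-Solver

-- Conditional sampling by rejection

0<1 : 0ℚ ℚ.< 1ℚ
0<1 = ℚ.positive⁻¹ 1ℚ

fromWeights : ∀ {n} (f : Fin n → ℚ) (r : ℚ) → (∀ i → 0ℚ ℚ.≤ f i) → 0ℚ ℚ.≤ r → sum f ℚ.* r ≡ 1ℚ → Distribution n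
fromWeights f r 0≤f 0≤r Σf*r≡1 = record
  { prob        = λ i → fromℚ (f i ℚ.* r)
  ; nonNegative = λ i → fromℚ-mono-≤ (0≤p*q (0≤f i) 0≤r)
  ; total       = pointwise-≈ λ ν → trans (seq-∑ (λ i → fromℚ (f i ℚ.* r)) ν)
                    (trans (sym (*-distribʳ-sum r f)) Σf*r≡1)
  }

mean : ∀ {k} → Distribution k → (Fin k → ℝ) → ℝ
mean ρ x = ∑ λ r → prob ρ r * x r

mean-mono-≤ : ∀ {k} (ρ : Distribution k) {x y} → (∀ r → x r ≤ y r) → mean ρ x ≤ mean ρ y
mean-mono-≤ ρ x≤y = ∑-mono-≤ λ r → *-monoˡ-≤ (prob ρ r) (nonNegative ρ r) (x≤y r)

0≤mean : ∀ {k} (ρ : Distribution k) {x} → (∀ r → 0ℝ ≤ x r) → 0ℝ ≤ mean ρ x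
0≤mean ρ 0≤x = 0≤∑ λ r → 0≤x*y (nonNegative ρ r) (0≤x r)

seq-mean-+ : ∀ {k} (ρ : Distribution k) x y ν →
  seq (mean ρ (λ r → x r + y r)) ν ≡ seq (mean ρ x + mean ρ y) ν
seq-mean-+ ρ x y ν = begin
  seq (mean ρ (λ r → x r + y r)) ν
    ≡⟨ seq-∑ (λ r → prob ρ r * (x r + y r)) ν ⟩
  sum (λ r → seq (prob ρ r) ν ℚ.* (seq (x r) ν ℚ.+ seq (y r) ν))
    ≡⟨ sum-cong-≗ (λ r → ℚ.*-distribˡ-+ (seq (prob ρ r) ν) (seq (x r) ν) (seq (y r) ν)) ⟩
  sum (λ r → seq (prob ρ r) ν ℚ.* seq (x r) ν ℚ.+ seq (prob ρ r) ν ℚ.* seq (y r) ν)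
    ≡⟨ ∑-distrib-+ (λ r → seq (prob ρ r) ν ℚ.* seq (x r) ν) _ ⟩
  sum (λ r → seq (prob ρ r) ν ℚ.* seq (x r) ν) ℚ.+ sum (λ r → seq (prob ρ r) ν ℚ.* seq (y r) ν)
    ≡⟨ cong₂ ℚ._+_ (seq-∑ (λ r → prob ρ r * x r) ν) (seq-∑ (λ r → prob ρ r * y r) ν) ⟨
  seq (mean ρ x + mean ρ y) ν ∎
  where open ≡-Reasoning

mean-const-≤ : ∀ {k} (ρ : Distribution k) {c} → 0ℝ ≤ c → mean ρ (λ _ → c) ≤ c
mean-const-≤ ρ {c} 0≤c = ≤-trans
  (pointwise-≤ λ ν → ℚ.≤-reflexive (begin
    seq (mean ρ (λ _ → c)) ν                        ≡⟨ seq-∑ (λ r → prob ρ r * c) ν ⟩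
    sum (λ r → seq (prob ρ r) ν ℚ.* seq c ν)        ≡⟨ *-distribʳ-sum (seq c ν) (λ r → seq (prob ρ r) ν) ⟨
    sum (λ r → seq (prob ρ r) ν) ℚ.* seq c ν        ≡⟨ ℚ.*-comm _ (seq c ν) ⟩
    seq c ν ℚ.* sum (λ r → seq (prob ρ r) ν)        ≡⟨ cong (seq c ν ℚ.*_) (seq-∑ (prob ρ) ν) ⟨
    seq (c * ∑ (prob ρ)) ν                          ∎))
  (≤-trans (*-monoˡ-≤ c 0≤c (≈⇒≤ (total ρ))) (pointwise-≤ λ ν → ℚ.≤-reflexive (ℚ.*-identityʳ (seq c ν))))
  where open ≡-Reasoning

mean-+const-≤ : ∀ {k} (ρ : Distribution k) {x y c} → 0ℝ ≤ c →
  (∀ r → x r ≤ y r + c) → mean ρ x ≤ mean ρ y + c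
mean-+const-≤ ρ {y = y} {c} 0≤c x≤y+c = ≤-trans (mean-mono-≤ ρ x≤y+c)
  (≤-trans (pointwise-≤ λ ν → ℚ.≤-reflexive (seq-mean-+ ρ y (λ _ → c) ν))
    (+-mono-≤ ≤-refl (mean-const-≤ ρ 0≤c)))

module _ {n} (O : Oracle n) where

  0≤outcome : ∀ {q} (T : Adaptive n q) b → 0ℝ ≤ outcome O T b
  0≤outcome (output true)   true  = fromℚ-mono-≤ (ℚ.<⇒≤ 0<1)
  0≤outcome (output true)   false = ≤-refl
  0≤outcome (output false)  true  = ≤-refl
  0≤outcome (output false)  false = fromℚ-mono-≤ (ℚ.<⇒≤ 0<1)
  0≤outcome (toss ρ t)      b     = 0≤mean ρ λ r → 0≤outcome (t r) b
  0≤outcome (sample A ne t) b     = 0≤mean (O A ne) λ j → 0≤outcome (t j) b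

  outcome-total : ∀ {q} (T : Adaptive n q) → outcome O T true + outcome O T false ≤ 1ℝ
  outcome-total-mean : ∀ {k q} (ρ : Distribution k) (t : Fin k → Adaptive n q) →
    mean ρ (λ r → outcome O (t r) true) + mean ρ (λ r → outcome O (t r) false) ≤ 1ℝ

  outcome-total (output true)   = pointwise-≤ λ _ → ℚ.≤-refl
  outcome-total (output false)  = pointwise-≤ λ _ → ℚ.≤-refl
  outcome-total (toss ρ t)      = outcome-total-mean ρ t
  outcome-total (sample A ne t) = outcome-total-mean (O A ne) t

  outcome-total-mean ρ t = ≤-trans
    (pointwise-≤ λ ν → ℚ.≤-reflexive (sym
      (seq-mean-+ ρ (λ r → outcome O (t r) true) (λ r → outcome O (t r) false) ν)))
    (≤-trans (mean-mono-≤ ρ (λ r → outcome-total (t r))) (mean-const-≤ ρ (fromℚ-mono-≤ (ℚ.<⇒≤ 0<1))))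

  outcome≤1 : ∀ {q} (T : Adaptive n q) → outcome O T true ≤ 1ℝ
  outcome≤1 T = ≤-trans (pointwise-≤ λ ν → ℚ.≤-reflexive (sym (ℚ.+-identityʳ _)))
    (≤-trans (+-mono-≤ (≤-refl {outcome O T true}) (0≤outcome T false)) (outcome-total T))

restrict : ∀ {n} → Subset n → (Fin n → ℚ) → Fin n → ℚ
restrict A w i = if lookup A i then w i else 0ℚ

measure : ∀ {n} → Subset n → (Fin n → ℚ) → ℚ
measure A w = sum (restrict A w)

restrict-mono-≤ : ∀ {n} (A : Subset n) {v w} → (∀ i → v i ℚ.≤ w i) → ∀ i → restrict A v i ℚ.≤ restrict A w i
restrict-mono-≤ A v≤w i with lookup A i
... | true  = v≤w i
... | false = ℚ.≤-refl

0≤restrict : ∀ {n} (A : Subset n) {w} → (∀ i → 0ℚ ℚ.≤ w i) → ∀ i → 0ℚ ℚ.≤ restrict A w i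
0≤restrict A 0≤w i with lookup A i
... | true  = 0≤w i
... | false = ℚ.≤-refl

restrict-∈ : ∀ {n} (A : Subset n) w {i} → lookup A i ≡ true → restrict A w i ≡ w i
restrict-∈ A w i∈A rewrite i∈A = refl

restrict-∉ : ∀ {n} (A : Subset n) w {i} → i ∉ A → restrict A w i ≡ 0ℚ
restrict-∉ A w {i} i∉A with lookup A i in eq
... | true  = contradiction (lookup⇒[]= i A eq) i∉A
... | false = refl

restrict-* : ∀ {n} (A : Subset n) w c i → restrict A (λ i → w i ℚ.* c) i ≡ restrict A w i ℚ.* c
restrict-* A w c i with lookup A i
... | true  = refl
... | false = sym (ℚ.*-zeroˡ c)

count : ∀ {n} → Subset n → ℚ
count A = measure A λ _ → 1ℚ

0<count : ∀ {n} (A : Subset n) → Nonempty A → 0ℚ ℚ.< count A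
0<count A (i , i∈A) = ℚ.<-≤-trans (subst (0ℚ ℚ.<_) (sym (restrict-∈ A (λ _ → 1ℚ) ([]=⇒lookup i∈A))) 0<1)
  (term≤sum (0≤restrict A λ _ → ℚ.<⇒≤ 0<1) i)

module Conditional {n} (w : Fin n → ℚ) (1≤w : ∀ i → 1ℚ ℚ.≤ w i) where

  0≤w : ∀ i → 0ℚ ℚ.≤ w i
  0≤w i = ℚ.≤-trans (ℚ.<⇒≤ 0<1) (1≤w i)

  count≤measure : ∀ A → count A ℚ.≤ measure A w
  count≤measure A = sum-mono-≤ (restrict-mono-≤ A 1≤w)

  0<measure : ∀ A → Nonempty A → 0ℚ ℚ.< measure A w
  0<measure A ne = ℚ.<-≤-trans (0<count A ne) (count≤measure A)

  measure⁻¹ : ∀ A → Nonempty A → ℚ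
  measure⁻¹ A ne = proj₁ (divide-pos (0<measure A ne) 0<1)

  measure*measure⁻¹ : ∀ A ne → measure A w ℚ.* measure⁻¹ A ne ≡ 1ℚ
  measure*measure⁻¹ A ne = proj₂ (proj₂ (divide-pos (0<measure A ne) 0<1))

  oracle : Oracle n
  oracle A ne = fromWeights (restrict A w) (measure⁻¹ A ne) (0≤restrict A 0≤w)
    (ℚ.<⇒≤ (proj₁ (proj₂ (divide-pos (0<measure A ne) 0<1)))) (measure*measure⁻¹ A ne)

  oracle-isConditional : ∀ r (0<r : 0ℚ ℚ.< r) (Σw*r≡1 : sum w ℚ.* r ≡ 1ℚ) →
    IsConditional (fromWeights w r 0≤w (ℚ.<⇒≤ 0<r) Σw*r≡1) oracle
  oracle-isConditional r 0<r Σw*r≡1 = record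
    { outside-A = λ A ne j j∉A → pointwise-≈ λ _ →
        trans (cong (ℚ._* measure⁻¹ A ne) (restrict-∉ A w j∉A)) (ℚ.*-zeroˡ (measure⁻¹ A ne))
    ; positive  = λ A ne j j∈A _ → pointwise-≈ λ ν → begin
        restrict A w j ℚ.* measure⁻¹ A ne ℚ.* seq (mass μ A) ν
          ≡⟨ cong₂ (λ p q → p ℚ.* measure⁻¹ A ne ℚ.* q) (restrict-∈ A w ([]=⇒lookup j∈A)) (seq-mass A ν) ⟩
        w j ℚ.* measure⁻¹ A ne ℚ.* (measure A w ℚ.* r)
          ≡⟨ solve 4 (λ w i m r → w :* i :* (m :* r) := w :* (m :* i) :* r) refl
               (w j) (measure⁻¹ A ne) (measure A w) r ⟩
        w j ℚ.* (measure A w ℚ.* measure⁻¹ A ne) ℚ.* r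
          ≡⟨ cong (λ p → w j ℚ.* p ℚ.* r) (measure*measure⁻¹ A ne) ⟩
        w j ℚ.* 1ℚ ℚ.* r
          ≡⟨ cong (ℚ._* r) (ℚ.*-identityʳ (w j)) ⟩
        w j ℚ.* r ∎
    ; null      = λ A ne j j∈A mass≈0 → contradiction
        (ℚ.<-≤-trans
          (subst (ℚ._< measure A w ℚ.* r) (ℚ.*-zeroˡ r)
            (ℚ.*-monoˡ-<-pos r {{ℚ.positive 0<r}} (0<measure A ne)))
          (fromℚ-cancel-≤ (≤-trans (pointwise-≤ λ ν → ℚ.≤-reflexive (sym (seq-mass A ν))) (≈⇒≤ mass≈0))))
        (ℚ.<-irrefl refl)
    }
    where
    open ≡-Reasoning
    open +-*-Solver

    μ : Distribution n
    μ = fromWeights w r 0≤w (ℚ.<⇒≤ 0<r) Σw*r≡1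

    seq-mass : ∀ A ν → seq (mass μ A) ν ≡ measure A w ℚ.* r
    seq-mass A ν = begin
      seq (mass μ A) ν                        ≡⟨ seq-∑ (λ i → if lookup A i then prob μ i else 0ℝ) ν ⟩
      sum (λ i → seq (if lookup A i then prob μ i else 0ℝ) ν)
                                              ≡⟨ sum-cong-≗ seq-restrict ⟩
      sum (λ i → restrict A w i ℚ.* r)        ≡⟨ *-distribʳ-sum r (restrict A w) ⟨
      measure A w ℚ.* r                       ∎
      where
      seq-restrict : ∀ i → seq (if lookup A i then prob μ i else 0ℝ) ν ≡ restrict A w i ℚ.* r
      seq-restrict i with lookup A i
      ... | true  = refl
      ... | false = sym (ℚ.*-zeroˡ r)

0<4count : ∀ {n} (A : Subset n) → Nonempty A → 0ℚ ℚ.< 4ℚ ℚ.* count A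
0<4count A ne = subst (ℚ._< 4ℚ ℚ.* count A) (ℚ.*-zeroʳ 4ℚ) (ℚ.*-monoʳ-<-pos 4ℚ (0<count A ne))

κ : ∀ {n} (A : Subset n) → Nonempty A → ℚ
κ A ne = proj₁ (divide-pos (0<4count A ne) 0<1)

0≤κ : ∀ {n} (A : Subset n) ne → 0ℚ ℚ.≤ κ A ne
0≤κ A ne = ℚ.<⇒≤ (proj₁ (proj₂ (divide-pos (0<4count A ne) 0<1)))

κ*count : ∀ {n} (A : Subset n) ne → κ A ne ℚ.* count A ≡ + 1 / 4
κ*count A ne = begin
  κ A ne ℚ.* count A
    ≡⟨ solve 2 (λ k c → k :* c := con (+ 1 / 4) :* (con 4ℚ :* c :* k)) refl (κ A ne) (count A) ⟩
  (+ 1 / 4) ℚ.* (4ℚ ℚ.* count A ℚ.* κ A ne)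
    ≡⟨ cong ((+ 1 / 4) ℚ.*_) (proj₂ (proj₂ (divide-pos (0<4count A ne) 0<1))) ⟩
  + 1 / 4                                    ∎
  where
  open ≡-Reasoning
  open +-*-Solver

-- Acceptance probability when each sample is simulated by rejection: a uniform
-- j ∈ A is kept with probability w(j)/4, and after D trials in all one rejects.
-- Unlike the outcome itself, this is a polynomial of degree D in the weights.
approx : ∀ {n q} → (Fin n → ℚ) → Adaptive n q → ℕ → ℝ
approx w (output b)      D       = if b then 1ℝ else 0ℝ
approx w (toss ρ t)      D       = mean ρ λ r → approx w (t r) D
approx w (sample A ne t) zero    = 0ℝ
approx w (sample A ne t) (suc D) =
  (∑ λ j → fromℚ (κ A ne ℚ.* restrict A w j) * approx w (t j) D) +
  fromℚ (1ℚ ℚ.- κ A ne ℚ.* measure A w) * approx w (sample A ne t) D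

-- error q D = 2^q (7/8)^D: a trial succeeds with probability s ≥ 1/4, and then
-- s + 2(1 − s) ≤ 2 · 7/8.
error : ℕ → ℕ → ℚ
error q       (suc D) = (+ 7 / 8) ℚ.* error q D
error zero    zero    = 1ℚ
error (suc q) zero    = 2ℚ ℚ.* error q zero

error-suc : ∀ q D → error (suc q) D ≡ 2ℚ ℚ.* error q D
error-suc q zero    = refl
error-suc q (suc D) = trans (cong ((+ 7 / 8) ℚ.*_) (error-suc q D))
  (solve 1 (λ e → con (+ 7 / 8) :* (con 2ℚ :* e) := con 2ℚ :* (con (+ 7 / 8) :* e)) refl (error q D))
  where open +-*-Solver

0≤error : ∀ q D → 0ℚ ℚ.≤ error q D
0≤error q       (suc D) = 0≤p*q (toWitness {a? = 0ℚ ℚ.≤? (+ 7 / 8)} _) (0≤error q D)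
0≤error zero    zero    = ℚ.<⇒≤ 0<1
0≤error (suc q) zero    = 0≤p*q (toWitness {a? = 0ℚ ℚ.≤? 2ℚ} _) (0≤error q zero)

1≤error : ∀ q → 1ℚ ℚ.≤ error q zero
1≤error zero    = ℚ.≤-refl
1≤error (suc q) = ℚ.≤-trans (1≤error q) (subst (error q zero ℚ.≤_)
  (solve 1 (λ e → e :+ e := con 2ℚ :* e) refl (error q zero)) (p≤p+q (error q zero) (0≤error q zero)))
  where open +-*-Solver

module Simulation {n} (w : Fin n → ℚ) (1≤w : ∀ i → 1ℚ ℚ.≤ w i) (w≤3 : ∀ i → w i ℚ.≤ 3ℚ) where
  open Conditional w 1≤w

  acceptance : ∀ A → Nonempty A → ℚ
  acceptance A ne = κ A ne ℚ.* measure A w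

  ¼≤acceptance : ∀ A ne → + 1 / 4 ℚ.≤ acceptance A ne
  ¼≤acceptance A ne = subst (ℚ._≤ acceptance A ne) (κ*count A ne)
    (ℚ.*-monoˡ-≤-nonNeg (κ A ne) {{ℚ.nonNegative (0≤κ A ne)}} (count≤measure A))

  acceptance≤1 : ∀ A ne → acceptance A ne ℚ.≤ 1ℚ
  acceptance≤1 A ne = begin
    κ A ne ℚ.* measure A w
      ≤⟨ ℚ.*-monoˡ-≤-nonNeg (κ A ne) {{ℚ.nonNegative (0≤κ A ne)}} measure≤ ⟩
    κ A ne ℚ.* (count A ℚ.* 3ℚ)              ≡⟨ ℚ.*-assoc (κ A ne) (count A) 3ℚ ⟨
    κ A ne ℚ.* count A ℚ.* 3ℚ                ≡⟨ cong (ℚ._* 3ℚ) (κ*count A ne) ⟩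
    (+ 1 / 4) ℚ.* 3ℚ                         ≤⟨ toWitness {a? = (+ 1 / 4) ℚ.* 3ℚ ℚ.≤? 1ℚ} _ ⟩
    1ℚ                                       ∎
    where
    open ℚ.≤-Reasoning
    measure≤ : measure A w ℚ.≤ count A ℚ.* 3ℚ
    measure≤ = begin
      measure A w
        ≤⟨ sum-mono-≤ (restrict-mono-≤ A (λ i → ℚ.≤-trans (w≤3 i) (ℚ.≤-reflexive (sym (ℚ.*-identityˡ 3ℚ))))) ⟩
      measure A (λ _ → 1ℚ ℚ.* 3ℚ)                  ≡⟨ sum-cong-≗ (restrict-* A (λ _ → 1ℚ) 3ℚ) ⟩
      sum (λ i → restrict A (λ _ → 1ℚ) i ℚ.* 3ℚ)   ≡⟨ *-distribʳ-sum 3ℚ (restrict A (λ _ → 1ℚ)) ⟨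
      count A ℚ.* 3ℚ                               ∎

  step : ∀ (A : Subset n) → Nonempty A → (Fin n → ℝ) → ℝ → ℝ
  step A ne x y = (∑ λ j → fromℚ (κ A ne ℚ.* restrict A w j) * x j) + fromℚ (1ℚ ℚ.- acceptance A ne) * y

  seq-step : ∀ A ne x y ν → seq (step A ne x y) ν ≡
    κ A ne ℚ.* sum (λ j → restrict A w j ℚ.* seq (x j) ν) ℚ.+ (1ℚ ℚ.- acceptance A ne) ℚ.* seq y ν
  seq-step A ne x y ν = cong (ℚ._+ (1ℚ ℚ.- acceptance A ne) ℚ.* seq y ν) (begin
    seq (∑ λ j → fromℚ (κ A ne ℚ.* restrict A w j) * x j) ν
      ≡⟨ seq-∑ (λ j → fromℚ (κ A ne ℚ.* restrict A w j) * x j) ν ⟩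
    sum (λ j → κ A ne ℚ.* restrict A w j ℚ.* seq (x j) ν)
      ≡⟨ sum-cong-≗ (λ j → ℚ.*-assoc (κ A ne) (restrict A w j) (seq (x j) ν)) ⟩
    sum (λ j → κ A ne ℚ.* (restrict A w j ℚ.* seq (x j) ν))
      ≡⟨ *-distribˡ-sum (κ A ne) (λ j → restrict A w j ℚ.* seq (x j) ν) ⟨
    κ A ne ℚ.* sum (λ j → restrict A w j ℚ.* seq (x j) ν) ∎)
    where open ≡-Reasoning

  step-mono-≤ : ∀ A ne {x x′ y y′} → (∀ j → x j ≤ x′ j) → y ≤ y′ → step A ne x y ≤ step A ne x′ y′
  step-mono-≤ A ne x≤x′ y≤y′ = +-mono-≤
    (∑-mono-≤ λ j → *-monoˡ-≤ (fromℚ (κ A ne ℚ.* restrict A w j))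
      (fromℚ-mono-≤ (0≤p*q (0≤κ A ne) (0≤restrict A 0≤w j))) (x≤x′ j))
    (*-monoˡ-≤ (fromℚ (1ℚ ℚ.- acceptance A ne)) (fromℚ-mono-≤ (p≤q⇒0≤q-p (acceptance≤1 A ne))) y≤y′)

  -- One trial followed by genuine samples has the law of a genuine sample.
  step-mean : ∀ A ne x ν → seq (step A ne x (mean (oracle A ne) x)) ν ≡ seq (mean (oracle A ne) x) ν
  step-mean A ne x ν = begin
    seq (step A ne x (mean (oracle A ne) x)) ν
      ≡⟨ seq-step A ne x (mean (oracle A ne) x) ν ⟩
    k ℚ.* S ℚ.+ (1ℚ ℚ.- k ℚ.* M) ℚ.* seq (mean (oracle A ne) x) ν
      ≡⟨ cong (λ e → k ℚ.* S ℚ.+ (1ℚ ℚ.- k ℚ.* M) ℚ.* e) seq-mean ⟩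
    k ℚ.* S ℚ.+ (1ℚ ℚ.- k ℚ.* M) ℚ.* (i ℚ.* S)
      ≡⟨ solve 4 (λ k S M i → k :* S :+ (con 1ℚ :- k :* M) :* (i :* S) :=
           k :* S :+ i :* S :- k :* (M :* i) :* S) refl k S M i ⟩
    k ℚ.* S ℚ.+ i ℚ.* S ℚ.- k ℚ.* (M ℚ.* i) ℚ.* S
      ≡⟨ cong (λ e → k ℚ.* S ℚ.+ i ℚ.* S ℚ.- k ℚ.* e ℚ.* S) (measure*measure⁻¹ A ne) ⟩
    k ℚ.* S ℚ.+ i ℚ.* S ℚ.- k ℚ.* 1ℚ ℚ.* S
      ≡⟨ solve 3 (λ k S i → k :* S :+ i :* S :- k :* con 1ℚ :* S := i :* S) refl k S i ⟩
    i ℚ.* S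
      ≡⟨ seq-mean ⟨
    seq (mean (oracle A ne) x) ν ∎
    where
    open ≡-Reasoning
    open +-*-Solver
    k = κ A ne
    M = measure A w
    i = measure⁻¹ A ne
    S = sum λ j → restrict A w j ℚ.* seq (x j) ν

    seq-mean : seq (mean (oracle A ne) x) ν ≡ i ℚ.* S
    seq-mean = begin
      seq (mean (oracle A ne) x) ν
        ≡⟨ seq-∑ (λ j → prob (oracle A ne) j * x j) ν ⟩
      sum (λ j → restrict A w j ℚ.* i ℚ.* seq (x j) ν)
        ≡⟨ sum-cong-≗ (λ j → solve 3 (λ r i x → r :* i :* x := i :* (r :* x)) refl
             (restrict A w j) i (seq (x j) ν)) ⟩
      sum (λ j → i ℚ.* (restrict A w j ℚ.* seq (x j) ν))
        ≡⟨ *-distribˡ-sum i (λ j → restrict A w j ℚ.* seq (x j) ν) ⟨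
      i ℚ.* S ∎

  approx≤outcome : ∀ {q} (T : Adaptive n q) D → approx w T D ≤ outcome oracle T true
  approx≤outcome (output true)   D       = ≤-refl
  approx≤outcome (output false)  D       = ≤-refl
  approx≤outcome (toss ρ t)      D       = mean-mono-≤ ρ λ r → approx≤outcome (t r) D
  approx≤outcome (sample A ne t) zero    = 0≤outcome oracle (sample A ne t) true
  approx≤outcome (sample A ne t) (suc D) = ≤-trans
    (step-mono-≤ A ne (λ j → approx≤outcome (t j) D) (approx≤outcome (sample A ne t) D))
    (pointwise-≤ λ ν → ℚ.≤-reflexive (step-mean A ne (λ j → outcome oracle (t j) true) ν))

  error-step : ∀ q D A ne →
    acceptance A ne ℚ.* error q D ℚ.+ (1ℚ ℚ.- acceptance A ne) ℚ.* error (suc q) D ℚ.≤ error (suc q) (suc D)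
  error-step q D A ne = 0≤q-p⇒p≤q (subst (0ℚ ℚ.≤_)
    (trans (solve 2 (λ s e → (s :- con (+ 1 / 4)) :* e :=
        con (+ 7 / 8) :* (con 2ℚ :* e) :- (s :* e :+ (con 1ℚ :- s) :* (con 2ℚ :* e))) refl
             (acceptance A ne) (error q D))
      (cong (λ e → (+ 7 / 8) ℚ.* e ℚ.- (acceptance A ne ℚ.* error q D ℚ.+ (1ℚ ℚ.- acceptance A ne) ℚ.* e))
        (sym (error-suc q D))))
    (0≤p*q (p≤q⇒0≤q-p (¼≤acceptance A ne)) (0≤error q D)))
    where open +-*-Solver

  step-+const : ∀ A ne x y c c′ ν →
    seq (step A ne (λ j → x j + fromℚ c) (y + fromℚ c′)) ν ≡
    seq (step A ne x y) ν ℚ.+ (acceptance A ne ℚ.* c ℚ.+ (1ℚ ℚ.- acceptance A ne) ℚ.* c′)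
  step-+const A ne x y c c′ ν = begin
    seq (step A ne (λ j → x j + fromℚ c) (y + fromℚ c′)) ν
      ≡⟨ seq-step A ne (λ j → x j + fromℚ c) (y + fromℚ c′) ν ⟩
    k ℚ.* sum (λ j → restrict A w j ℚ.* (seq (x j) ν ℚ.+ c)) ℚ.+ (1ℚ ℚ.- k ℚ.* M) ℚ.* (seq y ν ℚ.+ c′)
      ≡⟨ cong (λ s → k ℚ.* s ℚ.+ (1ℚ ℚ.- k ℚ.* M) ℚ.* (seq y ν ℚ.+ c′)) sum-+c ⟩
    k ℚ.* (S ℚ.+ M ℚ.* c) ℚ.+ (1ℚ ℚ.- k ℚ.* M) ℚ.* (seq y ν ℚ.+ c′)
      ≡⟨ solve 6 (λ k S M c y c′ → k :* (S :+ M :* c) :+ (con 1ℚ :- k :* M) :* (y :+ c′) :=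
           k :* S :+ (con 1ℚ :- k :* M) :* y :+ (k :* M :* c :+ (con 1ℚ :- k :* M) :* c′)) refl
           k S M c (seq y ν) c′ ⟩
    k ℚ.* S ℚ.+ (1ℚ ℚ.- k ℚ.* M) ℚ.* seq y ν ℚ.+ (k ℚ.* M ℚ.* c ℚ.+ (1ℚ ℚ.- k ℚ.* M) ℚ.* c′)
      ≡⟨ cong (ℚ._+ (k ℚ.* M ℚ.* c ℚ.+ (1ℚ ℚ.- k ℚ.* M) ℚ.* c′)) (seq-step A ne x y ν) ⟨
    seq (step A ne x y) ν ℚ.+ (k ℚ.* M ℚ.* c ℚ.+ (1ℚ ℚ.- k ℚ.* M) ℚ.* c′) ∎
    where
    open ≡-Reasoning
    open +-*-Solver
    k = κ A ne
    M = measure A w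
    S = sum λ j → restrict A w j ℚ.* seq (x j) ν

    sum-+c : sum (λ j → restrict A w j ℚ.* (seq (x j) ν ℚ.+ c)) ≡ S ℚ.+ M ℚ.* c
    sum-+c = begin
      sum (λ j → restrict A w j ℚ.* (seq (x j) ν ℚ.+ c))
        ≡⟨ sum-cong-≗ (λ j → ℚ.*-distribˡ-+ (restrict A w j) (seq (x j) ν) c) ⟩
      sum (λ j → restrict A w j ℚ.* seq (x j) ν ℚ.+ restrict A w j ℚ.* c)
        ≡⟨ ∑-distrib-+ (λ j → restrict A w j ℚ.* seq (x j) ν) (λ j → restrict A w j ℚ.* c) ⟩
      S ℚ.+ sum (λ j → restrict A w j ℚ.* c)
        ≡⟨ cong (S ℚ.+_) (*-distribʳ-sum c (restrict A w)) ⟨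
      S ℚ.+ M ℚ.* c ∎

  outcome≤approx+error : ∀ {q} (T : Adaptive n q) D → outcome oracle T true ≤ approx w T D + fromℚ (error q D)
  outcome≤approx+error {q} (output true)  D = pointwise-≤ λ _ → (p≤p+q 1ℚ (0≤error q D))
  outcome≤approx+error {q} (output false) D = pointwise-≤ λ _ → (p≤p+q 0ℚ (0≤error q D))
  outcome≤approx+error {q} (toss ρ t) D =
    mean-+const-≤ ρ (fromℚ-mono-≤ (0≤error q D)) λ r → outcome≤approx+error (t r) D
  outcome≤approx+error {q} (sample A ne t) zero =
    ≤-trans (outcome≤1 oracle (sample A ne t)) (pointwise-≤ λ _ →
      ℚ.≤-trans (1≤error q) (ℚ.≤-reflexive (sym (ℚ.+-identityˡ (error q zero)))))
  outcome≤approx+error {suc q} (sample A ne t) (suc D) = ≤-trans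
    (pointwise-≤ λ ν → ℚ.≤-reflexive (sym (step-mean A ne (λ j → outcome oracle (t j) true) ν)))
    (≤-trans
      (step-mono-≤ A ne (λ j → outcome≤approx+error (t j) D) (outcome≤approx+error (sample A ne t) D))
      (pointwise-≤ λ ν → ℚ.≤-trans
        (ℚ.≤-reflexive (step-+const A ne (λ j → approx w (t j) D) (approx w (sample A ne t) D)
           (error q D) (error (suc q) D) ν))
        (ℚ.+-monoʳ-≤ (seq (approx w (sample A ne t) (suc D)) ν) (error-step q D A ne))))

-- The property

0<sum : ∀ {n} {f : Fin n → ℚ} → (∀ i → 0ℚ ℚ.< f i) → 0 ℕ.< n → 0ℚ ℚ.< sum f
0<sum {suc n} 0<f _ = ℚ.+-mono-<-≤ (0<f zero) (0≤sum λ i → ℚ.<⇒≤ (0<f (suc i)))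

module HardProperty {n d} (0<n : 0 ℕ.< n) (F : HardFamily n d) where
  open HardFamily F

  totalWeight : ℚ
  totalWeight = sum {n} λ _ → 2ℚ

  0<totalWeight : 0ℚ ℚ.< totalWeight
  0<totalWeight = 0<sum (λ _ → ℚ.positive⁻¹ 2ℚ) 0<n

  scale : ℚ
  scale = proj₁ (divide-pos 0<totalWeight 0<1)

  0<scale : 0ℚ ℚ.< scale
  0<scale = proj₁ (proj₂ (divide-pos 0<totalWeight 0<1))

  totalWeight*scale : totalWeight ℚ.* scale ≡ 1ℚ
  totalWeight*scale = proj₂ (proj₂ (divide-pos 0<totalWeight 0<1))

  module Cond a = Conditional (weights a) (1≤weights a)
  module Sim a = Simulation (weights a) (1≤weights a) (weights≤3 a)

  weights*scale : ∀ a → sum (weights a) ℚ.* scale ≡ 1ℚ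
  weights*scale a = trans (cong (ℚ._* scale) (sum-weights a)) totalWeight*scale

  μ : Fin size → Distribution n
  μ a = fromWeights (weights a) scale (Cond.0≤w a) (ℚ.<⇒≤ 0<scale) (weights*scale a)

  oracle-conditional : ∀ a → IsConditional (μ a) (Cond.oracle a)
  oracle-conditional a = Cond.oracle-isConditional a scale 0<scale (weights*scale a)

  property : Property n
  property = record
    { Member  = λ ρ → ∃ λ a → 0ℚ ℚ.< coeff a × (∀ i → prob ρ i ≈ prob (μ a) i)
    ; respect = λ ρ ρ′ ρ≈ρ′ (a , 0<z , ρ≈μ) → a , 0<z , λ i → ≈-trans (≈-sym (ρ≈ρ′ i)) (ρ≈μ i)
    }

  μ-member : ∀ a → 0ℚ ℚ.< coeff a → Member property (μ a)
  μ-member a 0<z = a , 0<z , λ i → pointwise-≈ λ _ → refl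

  μ-far : ∀ b → coeff b ℚ.≤ 0ℚ → Far (fromℚ (+ 1 / 80)) property (μ b)
  μ-far b z≤0 ρ (a , 0<z , ρ≈μ) = ≤-trans
    (pointwise-≤ λ ν → ε≤variation ν)
    (*-monoˡ-≤ (fromℚ ½) (fromℚ-mono-≤ (ℚ.<⇒≤ (ℚ.positive⁻¹ ½))) (∑-mono-≤ closer))
    where
    open +-*-Solver

    b≢a : b ≢ a
    b≢a refl = ℚ.<-irrefl refl (ℚ.<-≤-trans 0<z z≤0)

    ε≤variation : ∀ ν → + 1 / 80 ℚ.≤ seq (variation (μ b) (μ a)) ν
    ε≤variation ν = begin
      + 1 / 80                                            ≡⟨⟩
      (+ 1 / 80) ℚ.* 1ℚ                                   ≡⟨ cong ((+ 1 / 80) ℚ.*_) totalWeight*scale ⟨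
      (+ 1 / 80) ℚ.* (totalWeight ℚ.* scale)
        ≡⟨ solve 2 (λ W r → con (+ 1 / 80) :* (W :* r) := con ½ :* (con (+ 1 / 40) :* W :* r)) refl
             totalWeight scale ⟩
      ½ ℚ.* ((+ 1 / 40) ℚ.* totalWeight ℚ.* scale)
        ≤⟨ ℚ.*-monoˡ-≤-nonNeg ½ (ℚ.*-monoʳ-≤-nonNeg scale {{ℚ.nonNegative (ℚ.<⇒≤ 0<scale)}} (separated b a b≢a)) ⟩
      ½ ℚ.* (distance (weights b) (weights a) ℚ.* scale)
        ≡⟨ cong (½ ℚ.*_) (trans (*-distribʳ-sum scale (λ i → ℚ.∣ weights b i ℚ.- weights a i ∣))
             (sum-cong-≗ (λ i → scale-∣∣ (weights b i) (weights a i)))) ⟩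
      ½ ℚ.* sum (λ i → ℚ.∣ weights b i ℚ.* scale ℚ.- weights a i ℚ.* scale ∣)
        ≡⟨ cong (½ ℚ.*_) (seq-∑ (λ i → ∣ prob (μ b) i - prob (μ a) i ∣) ν) ⟨
      seq (variation (μ b) (μ a)) ν                       ∎
      where
      open ℚ.≤-Reasoning
      scale-∣∣ : ∀ p q → ℚ.∣ p ℚ.- q ∣ ℚ.* scale ≡ ℚ.∣ p ℚ.* scale ℚ.- q ℚ.* scale ∣
      scale-∣∣ p q = trans (cong (ℚ.∣ p ℚ.- q ∣ ℚ.*_) (sym (ℚ.0≤p⇒∣p∣≡p (ℚ.<⇒≤ 0<scale))))
        (trans (sym (ℚ.∣p*q∣≡∣p∣*∣q∣ (p ℚ.- q) scale))
          (cong ℚ.∣_∣ (solve 3 (λ p q r → (p :- q) :* r := p :* r :- q :* r) refl p q scale)))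

    closer : ∀ i → ∣ prob (μ b) i - prob (μ a) i ∣ ≤ ∣ prob (μ b) i - prob ρ i ∣
    closer i = ≤-intro λ ε 0<ε →
      let N , close = ≈-elim (ρ≈μ i) ε 0<ε in
      N , λ ν N≤ν →
        let x = weights b i ℚ.* scale
            y = weights a i ℚ.* scale
            z = seq (prob ρ i) ν
        in ℚ.≤-<-trans
          (subst (λ e → ℚ.∣ e ∣ ℚ.≤ ℚ.∣ x ℚ.- z ∣ ℚ.+ ℚ.∣ z ℚ.- y ∣)
            (solve 3 (λ x y z → (x :- z) :+ (z :- y) := x :- y) refl x y z)
            (ℚ.∣p+q∣≤∣p∣+∣q∣ (x ℚ.- z) (z ℚ.- y)))
          (ℚ.+-monoʳ-< ℚ.∣ x ℚ.- z ∣ (close ν N≤ν))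

  -- Abstracts from the polynomials of degree at most D in the weights, which
  -- coeff annihilates along with their multiples of degree at most d.
  Null : ℕ → (Fin size → ℚ) → Set
  Null D f = ∀ M → length M ℕ.+ D ℕ.≤ d → sum (λ a → coeff a ℚ.* (weightProduct (weights a) M ℚ.* f a)) ≡ 0ℚ

  null-cong : ∀ {D f g} → (∀ a → f a ≡ g a) → Null D f → Null D g
  null-cong f≡g f-null M ≤d = trans
    (sum-cong-≗ λ a → cong (λ e → coeff a ℚ.* (weightProduct (weights a) M ℚ.* e)) (sym (f≡g a)))
    (f-null M ≤d)

  null-suc : ∀ {D f} → Null D f → Null (suc D) f
  null-suc f-null M ≤d = f-null M (ℕ.≤-trans (ℕ.+-monoʳ-≤ (length M) (ℕ.n≤1+n _)) ≤d)

  null-scale : ∀ {D f} c → Null D f → Null D (λ a → c ℚ.* f a)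
  null-scale {D} {f} c f-null M ≤d = begin
    sum (λ a → coeff a ℚ.* (weightProduct (weights a) M ℚ.* (c ℚ.* f a)))
      ≡⟨ sum-cong-≗ (λ a → solve 4 (λ z p c f → z :* (p :* (c :* f)) := c :* (z :* (p :* f))) refl
           (coeff a) (weightProduct (weights a) M) c (f a)) ⟩
    sum (λ a → c ℚ.* (coeff a ℚ.* (weightProduct (weights a) M ℚ.* f a)))
      ≡⟨ *-distribˡ-sum c (λ a → coeff a ℚ.* (weightProduct (weights a) M ℚ.* f a)) ⟨
    c ℚ.* sum (λ a → coeff a ℚ.* (weightProduct (weights a) M ℚ.* f a))
      ≡⟨ trans (cong (c ℚ.*_) (f-null M ≤d)) (ℚ.*-zeroʳ c) ⟩
    0ℚ ∎
    where
    open ≡-Reasoning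
    open +-*-Solver

  null-const : ∀ {D} c → Null D (λ _ → c)
  null-const {D} c = null-cong (λ _ → ℚ.*-identityʳ c) (null-scale {D} c λ M ≤d → trans
    (sum-cong-≗ λ a → cong (coeff a ℚ.*_) (ℚ.*-identityʳ (weightProduct (weights a) M)))
    (coeff-null M (ℕ.≤-trans (ℕ.m≤m+n (length M) D) ≤d)))

  null-sum : ∀ {D k} {f : Fin k → Fin size → ℚ} → (∀ r → Null D (f r)) → Null D (λ a → sum λ r → f r a)
  null-sum {D} {k} {f} f-null M ≤d = begin
    sum (λ a → coeff a ℚ.* (weightProduct (weights a) M ℚ.* sum (λ r → f r a)))
      ≡⟨ sum-cong-≗ (λ a → trans
           (cong (coeff a ℚ.*_) (*-distribˡ-sum (weightProduct (weights a) M) (λ r → f r a)))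
           (*-distribˡ-sum (coeff a) (λ r → weightProduct (weights a) M ℚ.* f r a))) ⟩
    sum (λ a → sum (λ r → coeff a ℚ.* (weightProduct (weights a) M ℚ.* f r a)))
      ≡⟨ ∑-comm (λ a r → coeff a ℚ.* (weightProduct (weights a) M ℚ.* f r a)) ⟩
    sum (λ r → sum (λ a → coeff a ℚ.* (weightProduct (weights a) M ℚ.* f r a)))
      ≡⟨ sum-zero (λ r → f-null r M ≤d) ⟩
    0ℚ ∎
    where open ≡-Reasoning

  null-+ : ∀ {D f g} → Null D f → Null D g → Null D (λ a → f a ℚ.+ g a)
  null-+ {D} {f} {g} f-null g-null M ≤d = begin
    sum (λ a → coeff a ℚ.* (weightProduct (weights a) M ℚ.* (f a ℚ.+ g a)))
      ≡⟨ sum-cong-≗ (λ a → solve 4 (λ z p f g → z :* (p :* (f :+ g)) := z :* (p :* f) :+ z :* (p :* g)) refl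
           (coeff a) (weightProduct (weights a) M) (f a) (g a)) ⟩
    sum (λ a → coeff a ℚ.* (weightProduct (weights a) M ℚ.* f a) ℚ.+
               coeff a ℚ.* (weightProduct (weights a) M ℚ.* g a))
      ≡⟨ ∑-distrib-+ (λ a → coeff a ℚ.* (weightProduct (weights a) M ℚ.* f a)) _ ⟩
    sum (λ a → coeff a ℚ.* (weightProduct (weights a) M ℚ.* f a)) ℚ.+
    sum (λ a → coeff a ℚ.* (weightProduct (weights a) M ℚ.* g a))
      ≡⟨ cong₂ ℚ._+_ (f-null M ≤d) (g-null M ≤d) ⟩
    0ℚ ∎
    where
    open ≡-Reasoning
    open +-*-Solver

  null-weight : ∀ {D f} j → Null D f → Null (suc D) (λ a → weights a j ℚ.* f a)
  null-weight {D} {f} j f-null M ≤d = trans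
    (sum-cong-≗ λ a → solve 4 (λ z p w f → z :* (p :* (w :* f)) := z :* (w :* p :* f)) refl
      (coeff a) (weightProduct (weights a) M) (weights a j) (f a))
    (f-null (j ∷ M) (subst (ℕ._≤ d) (ℕ.+-suc (length M) D) ≤d))
    where open +-*-Solver

  null-restrict : ∀ {D f} A j → Null D f → Null (suc D) (λ a → restrict A (weights a) j ℚ.* f a)
  null-restrict {D} {f} A j f-null with lookup A j
  ... | true  = null-weight j f-null
  ... | false = null-cong (λ a → sym (ℚ.*-zeroˡ (f a))) (null-const {suc D} 0ℚ)

  approx-null : ∀ {q} (T : Adaptive n q) D ν → Null D (λ a → seq (approx (weights a) T D) ν)
  approx-null (output b) D ν = null-const (seq (if b then 1ℝ else 0ℝ) ν)
  approx-null (toss ρ t) D ν = null-cong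
    (λ a → sym (seq-∑ (λ r → prob ρ r * approx (weights a) (t r) D) ν))
    (null-sum λ r → null-scale (seq (prob ρ r) ν) (approx-null (t r) D ν))
  approx-null (sample A ne t) zero    ν = null-const 0ℚ
  approx-null (sample A ne t) (suc D) ν = null-cong expand (null-+
    (null-scale (κ A ne) (null-sum λ j → null-restrict A j (approx-null (t j) D ν)))
    (null-+ (null-suc (approx-null (sample A ne t) D ν))
            (null-scale (ℚ.- κ A ne) (null-sum λ j → null-restrict A j (approx-null (sample A ne t) D ν)))))
    where
    open +-*-Solver

    expand : ∀ a → let y = seq (approx (weights a) (sample A ne t) D) ν in
      κ A ne ℚ.* sum (λ j → restrict A (weights a) j ℚ.* seq (approx (weights a) (t j) D) ν) ℚ.+
        (y ℚ.+ (ℚ.- κ A ne) ℚ.* sum (λ j → restrict A (weights a) j ℚ.* y)) ≡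
      seq (approx (weights a) (sample A ne t) (suc D)) ν
    expand a = begin
      k ℚ.* X ℚ.+ (y ℚ.+ (ℚ.- k) ℚ.* sum (λ j → restrict A (weights a) j ℚ.* y))
        ≡⟨ cong (λ e → k ℚ.* X ℚ.+ (y ℚ.+ (ℚ.- k) ℚ.* e)) (*-distribʳ-sum y (restrict A (weights a))) ⟨
      k ℚ.* X ℚ.+ (y ℚ.+ (ℚ.- k) ℚ.* (measure A (weights a) ℚ.* y))
        ≡⟨ solve 4 (λ k X m y → k :* X :+ (y :+ (:- k) :* (m :* y)) := k :* X :+ (con 1ℚ :- k :* m) :* y) refl
             k X (measure A (weights a)) y ⟩
      k ℚ.* X ℚ.+ (1ℚ ℚ.- k ℚ.* measure A (weights a)) ℚ.* y
        ≡⟨ Sim.seq-step a A ne (λ j → approx (weights a) (t j) D) (approx (weights a) (sample A ne t) D) ν ⟨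
      seq (approx (weights a) (sample A ne t) (suc D)) ν ∎
      where
      open ≡-Reasoning
      k = κ A ne
      y = seq (approx (weights a) (sample A ne t) D) ν
      X = sum (λ j → restrict A (weights a) j ℚ.* seq (approx (weights a) (t j) D) ν)

  module _ {q} (T : Adaptive n q) (tester : IsTester property (fromℚ (+ 1 / 80)) (fromℚ (+ 1 / 3)) T)
           D (error≤ : error q D ℚ.≤ + 1 / 12) where
    open IsTester tester
    open +-*-Solver

    accepted : ∀ a → 0ℚ ℚ.< coeff a → fromℚ (+ 7 / 12) ≤ approx (weights a) T D
    accepted a 0<z = ≤-trans
      (pointwise-≤ {y = 1ℝ - fromℚ (+ 1 / 3) + fromℚ (ℚ.- (+ 1 / 12))} λ _ → ℚ.≤-refl)
      (≤-trans
        (+-mono-≤ (≤-trans (completeness (μ a) (μ-member a 0<z) (Cond.oracle a) (oracle-conditional a))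
                           (Sim.outcome≤approx+error a T D))
                  (fromℚ-mono-≤ {ℚ.- (+ 1 / 12)} {ℚ.- error q D} (ℚ.neg-antimono-≤ error≤)))
        (pointwise-≤ λ ν → ℚ.≤-reflexive
          (solve 2 (λ p e → p :+ e :+ :- e := p) refl (seq (approx (weights a) T D) ν) (error q D))))

    rejected : ∀ a → coeff a ℚ.≤ 0ℚ → approx (weights a) T D ≤ fromℚ (+ 1 / 3)
    rejected a z≤0 = ≤-trans (Sim.approx≤outcome a T D) (≤-trans
      (pointwise-≤ {y = outcome (Cond.oracle a) T true + (1ℝ - fromℚ (+ 1 / 3)) + fromℚ (ℚ.- (+ 2 / 3))} λ ν →
        ℚ.≤-reflexive (solve 1 (λ p → p := p :+ con (+ 2 / 3) :+ con (ℚ.- (+ 2 / 3))) refl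
          (seq (outcome (Cond.oracle a) T true) ν)))
      (≤-trans
        (+-mono-≤
          (≤-trans
            (+-mono-≤ ≤-refl (soundness (μ a) (μ-far a z≤0) (Cond.oracle a) (oracle-conditional a)))
            (outcome-total (Cond.oracle a) T))
          ≤-refl)
        (pointwise-≤ {1ℝ + fromℚ (ℚ.- (+ 2 / 3))} λ _ → ℚ.≤-refl)))

    separates : ∀ a →
      fromℚ (coeff a ℚ.* ½ ℚ.+ ℚ.∣ coeff a ∣ ℚ.* (+ 1 / 12)) ≤ fromℚ (coeff a) * approx (weights a) T D
    separates a with coeff a ℚ.≤? 0ℚ
    ... | no z≰0 = ≤-trans
      (pointwise-≤ λ ν → ℚ.≤-reflexive (trans
        (cong (λ e → z ℚ.* ½ ℚ.+ e ℚ.* (+ 1 / 12)) (ℚ.0≤p⇒∣p∣≡p (ℚ.<⇒≤ 0<z)))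
        (solve 1 (λ z → z :* con ½ :+ z :* con (+ 1 / 12) := z :* con (+ 7 / 12)) refl z)))
      (*-monoˡ-≤ (fromℚ z) (fromℚ-mono-≤ (ℚ.<⇒≤ 0<z)) (accepted a 0<z))
      where
      z = coeff a
      0<z : 0ℚ ℚ.< z
      0<z = ℚ.≰⇒> z≰0
    ... | yes z≤0 = ≤-trans
      (pointwise-≤ λ ν → ℚ.≤-trans
        (0≤q-p⇒p≤q (subst (0ℚ ℚ.≤_)
          (trans (solve 1 (λ z → (con 0ℚ :- z) :* con (+ 1 / 12) :=
                   z :* con (+ 1 / 3) :- (z :* con ½ :+ (:- z) :* con (+ 1 / 12))) refl z)
            (cong (λ e → z ℚ.* (+ 1 / 3) ℚ.- (z ℚ.* ½ ℚ.+ e ℚ.* (+ 1 / 12))) (sym ∣z∣≡-z)))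
          (0≤p*q 0≤-z (ℚ.<⇒≤ (ℚ.positive⁻¹ (+ 1 / 12))))))
        (ℚ.≤-reflexive (solve 2 (λ z p →
          z :* con (+ 1 / 3) := (con 0ℚ :- z) :* p :+ (z :* p :+ z :* con (+ 1 / 3))) refl z (p ν))))
      (≤-trans
        (+-mono-≤ (*-monoˡ-≤ (fromℚ (0ℚ ℚ.- z)) (fromℚ-mono-≤ 0≤-z) (rejected a z≤0))
                  (≤-refl {fromℚ z * approx (weights a) T D + fromℚ (z ℚ.* (+ 1 / 3))}))
        (pointwise-≤ λ ν → ℚ.≤-reflexive (solve 2 (λ z p →
          (con 0ℚ :- z) :* con (+ 1 / 3) :+ (z :* p :+ z :* con (+ 1 / 3)) := z :* p) refl z (p ν))))
      where
      z = coeff a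

      p : ℕ → ℚ
      p = seq (approx (weights a) T D)

      0≤-z : 0ℚ ℚ.≤ 0ℚ ℚ.- z
      0≤-z = p≤q⇒0≤q-p z≤0

      ∣z∣≡-z : ℚ.∣ z ∣ ≡ ℚ.- z
      ∣z∣≡-z = trans (sym (ℚ.∣-p∣≡∣p∣ z)) (ℚ.0≤p⇒∣p∣≡p (subst (0ℚ ℚ.≤_) (ℚ.+-identityˡ (ℚ.- z)) 0≤-z))

    ∑coeff*approx≡0 : D ℕ.≤ d → ∀ ν → seq (∑ λ a → fromℚ (coeff a) * approx (weights a) T D) ν ≡ 0ℚ
    ∑coeff*approx≡0 D≤d ν = trans (seq-∑ (λ a → fromℚ (coeff a) * approx (weights a) T D) ν)
      (trans (sum-cong-≗ λ a → cong (coeff a ℚ.*_) (sym (ℚ.*-identityˡ (seq (approx (weights a) T D) ν))))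
        (approx-null T D ν [] D≤d))

    ∑coeff≡0 : sum coeff ≡ 0ℚ
    ∑coeff≡0 = trans (sum-cong-≗ λ a → sym (ℚ.*-identityʳ (coeff a))) (coeff-null [] z≤n)

    ∑-separates :
      sum (λ a → coeff a ℚ.* ½ ℚ.+ ℚ.∣ coeff a ∣ ℚ.* (+ 1 / 12)) ≡ sum (λ a → ℚ.∣ coeff a ∣) ℚ.* (+ 1 / 12)
    ∑-separates = begin
      sum (λ a → coeff a ℚ.* ½ ℚ.+ ℚ.∣ coeff a ∣ ℚ.* (+ 1 / 12))
        ≡⟨ ∑-distrib-+ (λ a → coeff a ℚ.* ½) (λ a → ℚ.∣ coeff a ∣ ℚ.* (+ 1 / 12)) ⟩
      sum (λ a → coeff a ℚ.* ½) ℚ.+ sum (λ a → ℚ.∣ coeff a ∣ ℚ.* (+ 1 / 12))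
        ≡⟨ cong₂ ℚ._+_ (*-distribʳ-sum ½ coeff) (*-distribʳ-sum (+ 1 / 12) (λ a → ℚ.∣ coeff a ∣)) ⟨
      sum coeff ℚ.* ½ ℚ.+ sum (λ a → ℚ.∣ coeff a ∣) ℚ.* (+ 1 / 12)
        ≡⟨ cong (λ e → e ℚ.* ½ ℚ.+ sum (λ a → ℚ.∣ coeff a ∣) ℚ.* (+ 1 / 12)) ∑coeff≡0 ⟩
      0ℚ ℚ.+ sum (λ a → ℚ.∣ coeff a ∣) ℚ.* (+ 1 / 12)
        ≡⟨ ℚ.+-identityˡ _ ⟩
      sum (λ a → ℚ.∣ coeff a ∣) ℚ.* (+ 1 / 12) ∎
      where open ≡-Reasoning

    0<∑∣coeff∣ : 0ℚ ℚ.< sum (λ a → ℚ.∣ coeff a ∣)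
    0<∑∣coeff∣ = let a , z≢0 = coeff≢0 in ℚ.<-≤-trans
      (ℚ.≰⇒> λ ∣z∣≤0 → z≢0 (ℚ.∣p∣≡0⇒p≡0 (coeff a) (ℚ.≤-antisym ∣z∣≤0 (ℚ.0≤∣p∣ (coeff a)))))
      (term≤sum (λ a → ℚ.0≤∣p∣ (coeff a)) a)

    d<D : d ℕ.< D
    d<D = ℕ.≰⇒> λ D≤d → ℚ.<-irrefl refl (ℚ.<-≤-trans
      (subst (ℚ._< sum (λ a → ℚ.∣ coeff a ∣) ℚ.* (+ 1 / 12)) (ℚ.*-zeroˡ (+ 1 / 12))
        (ℚ.*-monoˡ-<-pos (+ 1 / 12) 0<∑∣coeff∣))
      (fromℚ-cancel-≤ (≤-trans
        (pointwise-≤ λ ν → ℚ.≤-reflexive (trans (sym ∑-separates)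
          (sym (seq-∑ (λ a → fromℚ (coeff a ℚ.* ½ ℚ.+ ℚ.∣ coeff a ∣ ℚ.* (+ 1 / 12))) ν))))
        (≤-trans (∑-mono-≤ separates) (pointwise-≤ λ ν → ℚ.≤-reflexive (∑coeff*approx≡0 D≤d ν))))))

-- 2 (7/8)^6 ≤ 1
error-decreases : ∀ q D → error (suc q) (6 ℕ.+ D) ℚ.≤ error q D
error-decreases q D = begin
  error (suc q) (6 ℕ.+ D)                           ≡⟨ cong (λ e → f (f (f (f (f (f e)))))) (error-suc q D) ⟩
  f (f (f (f (f (f (2ℚ ℚ.* error q D))))))
    ≡⟨ solve 1 (λ e → let c = con (+ 7 / 8) in c :* (c :* (c :* (c :* (c :* (c :* (con 2ℚ :* e))))))
         := con (+ 117649 / 131072) :* e) refl (error q D) ⟩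
  (+ 117649 / 131072) ℚ.* error q D
    ≤⟨ ℚ.*-monoʳ-≤-nonNeg (error q D) {{ℚ.nonNegative (0≤error q D)}}
         (toWitness {a? = + 117649 / 131072 ℚ.≤? 1ℚ} _) ⟩
  1ℚ ℚ.* error q D                                  ≡⟨ ℚ.*-identityˡ (error q D) ⟩
  error q D                                         ∎
  where
  open ℚ.≤-Reasoning
  open +-*-Solver
  f : ℚ → ℚ
  f e = (+ 7 / 8) ℚ.* e

error≤1/12 : ∀ q → error q (q ℕ.* 6 ℕ.+ 19) ℚ.≤ + 1 / 12
error≤1/12 zero    = toWitness {a? = error 0 19 ℚ.≤? + 1 / 12} _
error≤1/12 (suc q) = ℚ.≤-trans (error-decreases q (q ℕ.* 6 ℕ.+ 19)) (error≤1/12 q)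

hardFamily-/40 : ∀ n → 40 ℕ.≤ n → HardFamily n (n ℕ./ 40)
hardFamily-/40 n 40≤n = subst (λ l → HardFamily l (n ℕ./ 40)) n≡ (hardFamily-20 (n ℕ./ 40)
  {{ℕ.>-nonZero (ℕ.m≥n⇒m/n>0 40≤n)}} (n ℕ.% 40) (ℕ.<⇒≤ (ℕ.m%n<n n 40)))
  where
  open ≡-Reasoning
  open ℕ.+-*-Solver
  n≡ : 20 ℕ.* (n ℕ./ 40) ℕ.* 2 ℕ.+ n ℕ.% 40 ≡ n
  n≡ = begin
    20 ℕ.* (n ℕ./ 40) ℕ.* 2 ℕ.+ n ℕ.% 40
      ≡⟨ solve 2 (λ k r → con 20 :* k :* con 2 :+ r := r :+ k :* con 40) refl (n ℕ./ 40) (n ℕ.% 40) ⟩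
    n ℕ.% 40 ℕ.+ (n ℕ./ 40) ℕ.* 40
      ≡⟨ ℕ.m≡m%n+[m/n]*n n 40 ⟨
    n ∎

hardProperty : ∀ n → Property n
hardProperty n with 40 ℕ.≤? n
... | yes 40≤n = HardProperty.property (ℕ.<-≤-trans (s≤s z≤n) 40≤n) (hardFamily-/40 n 40≤n)
... | no  _    = record { Member = λ _ → Empty.⊥ ; respect = λ _ _ _ () }

hardProperty-bound : ∀ {n} → 40 ℕ.≤ n → ∀ {q} (T : Adaptive n q) →
  IsTester (hardProperty n) (fromℚ (+ 1 / 80)) (fromℚ (+ 1 / 3)) T → n ℕ./ 40 ℕ.< q ℕ.* 6 ℕ.+ 19
hardProperty-bound {n} 40≤n {q} T tester with 40 ℕ.≤? n
... | yes 40≤n = HardProperty.d<D (ℕ.<-≤-trans (s≤s z≤n) 40≤n) (hardFamily-/40 n 40≤n) T tester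
      (q ℕ.* 6 ℕ.+ 19) (error≤1/12 q)
... | no  40≰n = contradiction 40≤n 40≰n

linear-bound : ∀ {n} q → 1520 ℕ.≤ n → n ℕ./ 40 ℕ.< q ℕ.* 6 ℕ.+ 19 → n ℕ.≤ 480 ℕ.* q
linear-bound {n} q 1520≤n n/40< = ℕ.≮⇒≥ λ 480q<n → ℕ.<⇒≱ n/40< (begin
  D                    ≡⟨ ℕ.m*n/n≡m D 40 ⟨
  D ℕ.* 40 ℕ./ 40      ≤⟨ ℕ./-monoˡ-≤ 40 (40D≤n (ℕ.<⇒≤ 480q<n)) ⟩
  n ℕ./ 40             ∎)
  where
  open ℕ.≤-Reasoning
  open ℕ.+-*-Solver

  D : ℕ
  D = q ℕ.* 6 ℕ.+ 19

  40D≤n : 480 ℕ.* q ℕ.≤ n → D ℕ.* 40 ℕ.≤ n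
  40D≤n 480q≤n = ℕ.*-cancelˡ-≤ {D ℕ.* 40} {n} 2 (begin
    2 ℕ.* (D ℕ.* 40)
      ≡⟨ solve 1 (λ q → con 2 :* ((q :* con 6 :+ con 19) :* con 40) := con 480 :* q :+ con 1520) refl q ⟩
    480 ℕ.* q ℕ.+ 1520   ≤⟨ ℕ.+-mono-≤ 480q≤n 1520≤n ⟩
    n ℕ.+ n              ≡⟨ cong (n ℕ.+_) (ℕ.+-identityʳ n) ⟨
    2 ℕ.* n              ∎)

theorem8p0p1 : ∃[ ε ] ∃[ c ] 0ℝ < ε × 0ℝ < c × (∃ λ (P : ∀ n → Property n) →
    ∃[ n₀ ] (∀ n → n₀ ℕ.≤ n → ∀ q →
    ((T : Adaptive n q) →
    IsTester (P n) ε (fromℚ (+ 1 / 3)) T → c * fromℕ n ≤ fromℕ q)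
    × ((T : NonAdaptive n q) →
    IsTester (P n) ε (fromℚ (+ 1 / 3)) (toAdaptive T) → c * fromℕ n ≤ fromℕ q)))
theorem8p0p1 =
  fromℚ (+ 1 / 80) , fromℚ (+ 1 / 480) ,
  fromℚ-mono-< (ℚ.positive⁻¹ (+ 1 / 80)) , fromℚ-mono-< (ℚ.positive⁻¹ (+ 1 / 480)) ,
  hardProperty , 1520 , λ n 1520≤n q →
    bound n 1520≤n q , λ T → bound n 1520≤n q (toAdaptive T)
  where
  bound : ∀ n → 1520 ℕ.≤ n → ∀ q (T : Adaptive n q) →
    IsTester (hardProperty n) (fromℚ (+ 1 / 80)) (fromℚ (+ 1 / 3)) T → fromℚ (+ 1 / 480) * fromℕ n ≤ fromℕ q
  bound n 1520≤n q T tester = pointwise-≤ λ _ → begin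
    (+ 1 / 480) ℚ.* ℕ→ℚ n
      ≤⟨ ℚ.*-monoˡ-≤-nonNeg (+ 1 / 480) (ℕ→ℚ-mono-≤ (linear-bound q 1520≤n
           (hardProperty-bound (ℕ.≤-trans (ℕ.m≤m+n 40 1480) 1520≤n) T tester))) ⟩
    (+ 1 / 480) ℚ.* ℕ→ℚ (480 ℕ.* q)
      ≡⟨ cong ((+ 1 / 480) ℚ.*_) (ℕ→ℚ-* 480 q) ⟩
    (+ 1 / 480) ℚ.* ((+ 480 / 1) ℚ.* ℕ→ℚ q)
      ≡⟨ solve 1 (λ q → con (+ 1 / 480) :* (con (+ 480 / 1) :* q) := q) refl (ℕ→ℚ q) ⟩
    ℕ→ℚ q ∎
    where
    open ℚ.≤-Reasoning
    open +-*-Solver
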